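{- Let $H$ be a linear forest and let $k\ge 1$, $n\ge 1$ be integers. Then for every complete $k$-partite graph $G$ on $n$ vertices (with parts $A_1,\dots,A_k$ partitioning the vertex set, some possibly empty), $$\mathcal{N}(H,G)\le \mathcal{N}(H,T(n,k)).$$
   Context: $\mathcal{N}(H,G)$ denotes the number of (not necessarily induced) subgraphs of $G$ isomorphic to $H$. A linear forest is a graph each of whose connected components is a path. The Turán graph $T(n,k)$ is the complete $k$-partite graph on $n$ vertices with each part of size $\lfloor n/k\rfloor$ or $\lceil n/k\rceil$. A complete $k$-partite graph with parts $A_1,\dots,A_k$ has an edge between two vertices exactly when they lie in different parts. -}

module Defs where

open import Data.Bool.Base using (true; false)
open import Data.Fin.Base using (Fin; zero; suc; toℕ; inject≤; splitAt; _↑ˡ_; _↑ʳ_)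
open import Data.Fin.Properties using (_≟_; all?; any?; splitAt-↑ˡ; splitAt-↑ʳ)
open import Data.Fin.Subset using (Subset; Side; inside; outside; _∈_; ∣_∣)
open import Data.Fin.Subset.Properties using (_∈?_)
open import Data.List.Base using (List; []; _∷_; length; filter; cartesianProduct; cartesianProductWith)
open import Data.Nat.Base using (ℕ; zero; suc; pred; _+_; _<_; _≤_; z≤n; s≤s; NonZero)
open import Data.Nat.DivMod using (_/_; 0/n≡0; n/n≡1; m<n⇒m/n≡0; +-distrib-/-∣ˡ)
open import Data.Nat.Divisibility using (∣-refl)
open import Data.Nat.Induction using (<-rec)
open import Data.Nat.Properties as ℕ using ()
open import Data.Product.Base using (∃; _×_; _,_)
open import Data.Sum.Base using (_⊎_; inj₁; inj₂; [_,_]′; swap) renaming (map to ⊎-map)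
open import Data.Vec.Base using (Vec; []; _∷_; lookup; tabulate)
open import Data.Vec.Properties using (tabulate-cong)
open import Function.Base using (_∘_; id)
open import Function.Bundles using (_⇔_; mk⇔; Equivalence)
open import Function.Definitions using (Injective)
open import Level using (0ℓ)
open import Relation.Binary.Construct.Closure.ReflexiveTransitive using (Star)
open import Relation.Binary.Core using (Rel)
open import Relation.Binary.Definitions using (Symmetric) renaming (Decidable to Decidable₂)
open import Relation.Binary.PropositionalEquality using (_≡_; _≢_; _≗_; refl; sym; trans; cong; cong₂; subst; module ≡-Reasoning)
open import Relation.Nullary.Decidable using (Dec; yes; no; does; map′; ¬?; _×-dec_; _⊎-dec_; _→-dec_)
open import Relation.Nullary.Negation using (¬_)
open import Relation.Unary using (Pred; Decidable)

private
  variable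
    h k n : ℕ

record Graph (n : ℕ) : Set₁ where
  field
    Adj    : Rel (Fin n) 0ℓ
    symm   : Symmetric Adj
    irrefl : ∀ v → ¬ Adj v v
    adj?   : Decidable₂ Adj

open Graph public

-- f is a graph isomorphism from H onto the graph whose vertices are the v
-- with V v and whose adjacency relation is E.
record IsIsomorphismOnto (H : Graph h) (V : Pred (Fin n) 0ℓ) (E : Rel (Fin n) 0ℓ)
                         (f : Fin h → Fin n) : Set where
  field
    injective : Injective _≡_ _≡_ f
    image     : ∀ v → V v ⇔ ∃ λ i → f i ≡ v
    adjacency : ∀ i j → Adj H i j ⇔ E (f i) (f j)

IsomorphicTo : Graph h → Pred (Fin n) 0ℓ → Rel (Fin n) 0ℓ → Set
IsomorphicTo H V E = ∃ λ f → IsIsomorphismOnto H V E f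

pathGraph : ∀ m → Graph m
pathGraph m = record
  { Adj    = λ i j → toℕ j ≡ suc (toℕ i) ⊎ toℕ i ≡ suc (toℕ j)
  ; symm   = swap
  ; irrefl = λ v → [ irr , irr ]′
  ; adj?   = λ i j → (toℕ j ℕ.≟ suc (toℕ i)) ⊎-dec (toℕ i ℕ.≟ suc (toℕ j))
  }
  where
  irr : ∀ {a} → ¬ (a ≡ suc a)
  irr = ℕ.<⇒≢ (ℕ.n<1+n _)

Connected : (H : Graph h) → Rel (Fin h) 0ℓ
Connected H = Star (Adj H)

-- The component of v has vertex set Connected H v and the edges of H
-- between these vertices.
LinearForest : Graph h → Set
LinearForest H = ∀ v → ∃ λ m → IsomorphicTo (pathGraph m) (Connected H v) (Adj H)

-- The partition A₁, …, A_k of the vertices is given by c, sending each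
-- vertex to the index of its part.
part : (Fin n → Fin k) → Fin k → Subset n
part c i = tabulate λ v → does (c v ≟ i)

IsCompletePartiteWith : (Fin n → Fin k) → Graph n → Set
IsCompletePartiteWith c G = ∀ u v → Adj G u v ⇔ c u ≢ c v

IsCompletePartite : ℕ → Graph n → Set
IsCompletePartite {n} k G = ∃ λ (c : Fin n → Fin k) → IsCompletePartiteWith c G

⌊_/_⌋ ⌈_/_⌉ : (n k : ℕ) .{{_ : NonZero k}} → ℕ
⌊ n / k ⌋ = n / k
⌈ n / k ⌉ = (n + pred k) / k

IsBalanced : .{{_ : NonZero k}} → (Fin n → Fin k) → Set
IsBalanced {k} {n} c = ∀ i → ∣ part c i ∣ ≡ ⌊ n / k ⌋ ⊎ ∣ part c i ∣ ≡ ⌈ n / k ⌉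

-- T is T(n,k), which is determined up to isomorphism; see turán-exists.
IsTurán : (k : ℕ) .{{_ : NonZero k}} → Graph n → Set
IsTurán {n} k T = ∃ λ (c : Fin n → Fin k) → IsCompletePartiteWith c T × IsBalanced c

-- A pair (V , E) encodes a vertex set and an edge set, E being given by the
-- rows of its adjacency matrix; distinct pairs encode distinct subgraphs.
EdgeOf : Vec (Subset n) n → Rel (Fin n) 0ℓ
EdgeOf E u v = v ∈ lookup E u

record IsSubgraph (G : Graph n) (V : Subset n) (E : Vec (Subset n) n) : Set where
  field
    symmetric : ∀ u v → EdgeOf E u v → EdgeOf E v u
    endpoints : ∀ u v → EdgeOf E u v → u ∈ V × v ∈ V
    edges     : ∀ u v → EdgeOf E u v → Adj G u v

IsCopy : Graph h → Graph n → Subset n × Vec (Subset n) n → Set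
IsCopy H G (V , E) = IsSubgraph G V E × IsomorphicTo H (_∈ V) (EdgeOf E)

private
  _⇔-dec_ : {A B : Set} → Dec A → Dec B → Dec (A ⇔ B)
  a? ⇔-dec b? = map′ (λ (f , g) → mk⇔ f g)
                     (λ e → Equivalence.to e , Equivalence.from e)
                     ((a? →-dec b?) ×-dec (b? →-dec a?))

  cons : Fin n → (Fin h → Fin n) → Fin (suc h) → Fin n
  cons x f zero    = x
  cons x f (suc i) = f i

  cons-cong : ∀ {x : Fin n} {f g : Fin h → Fin n} → f ≗ g → cons x f ≗ cons x g
  cons-cong f≗g zero    = refl
  cons-cong f≗g (suc i) = f≗g i

  cons-η : (f : Fin (suc h) → Fin n) → f ≗ cons (f zero) (f ∘ suc)
  cons-η f zero    = refl
  cons-η f (suc i) = refl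

anyFunction? : {P : Pred (Fin h → Fin n) 0ℓ} →
               (∀ {f g} → f ≗ g → P f → P g) → Decidable P → Dec (∃ P)
anyFunction? {zero}  resp P? =
  map′ (λ p → _ , p) (λ (f , p) → resp (λ ()) p) (P? λ ())
anyFunction? {suc h} resp P? =
  map′ (λ (x , f , p) → cons x f , p)
       (λ (f , p) → f zero , f ∘ suc , resp (cons-η f) p)
       (any? λ x → anyFunction? (resp ∘ cons-cong) (P? ∘ cons x))

module _ (H : Graph h) {V : Pred (Fin n) 0ℓ} {E : Rel (Fin n) 0ℓ} where

  private
    open IsIsomorphismOnto

    resp : ∀ {f g} → f ≗ g → IsIsomorphismOnto H V E f → IsIsomorphismOnto H V E g
    resp {f} {g} f≗g iso = record
      { injective = λ {i} {j} eq →
          injective iso (trans (f≗g i) (trans eq (sym (f≗g j))))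
      ; image = λ v → mk⇔
          (λ p → let (i , eq) = Equivalence.to (image iso v) p
                 in i , trans (sym (f≗g i)) eq)
          (λ (i , eq) → Equivalence.from (image iso v) (i , trans (f≗g i) eq))
      ; adjacency = λ i j → mk⇔
          (λ a → subst (E (g i)) (f≗g j)
                   (subst (λ x → E x (f j)) (f≗g i) (Equivalence.to (adjacency iso i j) a)))
          (λ e → Equivalence.from (adjacency iso i j)
                   (subst (E (f i)) (sym (f≗g j))
                     (subst (λ x → E x (g j)) (sym (f≗g i)) e)))
      }

  isIsomorphismOnto? : Decidable V → Decidable₂ E → Decidable (IsIsomorphismOnto H V E)
  isIsomorphismOnto? V? E? f = map′
    (λ (inj , im , ad) → record
      { injective = λ {i} {j} → inj i j ; image = im ; adjacency = ad })
    (λ iso → (λ i j → injective iso) , image iso , adjacency iso)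
    (     all? (λ i → all? λ j → (f i ≟ f j) →-dec (i ≟ j))
    ×-dec all? (λ v → V? v ⇔-dec any? (λ i → f i ≟ v))
    ×-dec all? (λ i → all? λ j → adj? H i j ⇔-dec E? (f i) (f j)))

  isomorphicTo? : Decidable V → Decidable₂ E → Dec (IsomorphicTo H V E)
  isomorphicTo? V? E? = anyFunction? resp (isIsomorphismOnto? V? E?)

edgeOf? : (E : Vec (Subset n) n) → Decidable₂ (EdgeOf E)
edgeOf? E u v = v ∈? lookup E u

isSubgraph? : (G : Graph n) (V : Subset n) (E : Vec (Subset n) n) → Dec (IsSubgraph G V E)
isSubgraph? G V E = map′
  (λ (s , p , e) → record { symmetric = s ; endpoints = p ; edges = e })
  (λ r → let open IsSubgraph r in symmetric , endpoints , edges)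
  (     all? (λ u → all? λ v → edgeOf? E u v →-dec edgeOf? E v u)
  ×-dec all? (λ u → all? λ v → edgeOf? E u v →-dec ((u ∈? V) ×-dec (v ∈? V)))
  ×-dec all? (λ u → all? λ v → edgeOf? E u v →-dec adj? G u v))

isCopy? : (H : Graph h) (G : Graph n) → Decidable (IsCopy H G)
isCopy? H G (V , E) = isSubgraph? G V E ×-dec isomorphicTo? H (_∈? V) (edgeOf? E)

-- All vectors with entries from xs; each occurs once if xs has no repetitions.
allVecs : {A : Set} → List A → ∀ m → List (Vec A m)
allVecs xs zero    = [] ∷ []
allVecs xs (suc m) = cartesianProductWith _∷_ xs (allVecs xs m)

allSubsets : ∀ n → List (Subset n)
allSubsets = allVecs (inside ∷ outside ∷ [])

𝓝 : Graph h → Graph n → ℕ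
𝓝 {n = n} H G =
  length (filter (isCopy? H G) (cartesianProduct (allSubsets n) (allVecs (allSubsets n) n)))

completePartite : (Fin n → Fin k) → Graph n
completePartite c = record
  { Adj    = λ u v → c u ≢ c v
  ; symm   = λ ne eq → ne (sym eq)
  ; irrefl = λ v ne → ne refl
  ; adj?   = λ u v → ¬? (c u ≟ c v)
  }

private
  size : (Fin n → Side) → ℕ
  size f = ∣ tabulate f ∣

  size-cong : {f g : Fin n → Side} → f ≗ g → size f ≡ size g
  size-cong f≗g = cong ∣_∣ (tabulate-cong f≗g)

  size-+ : ∀ m {n} (f : Fin (m + n) → Side) →
           size f ≡ size (λ j → f (j ↑ˡ n)) + size (λ j → f (m ↑ʳ j))
  size-+ zero    f = refl
  size-+ (suc m) f with f zero
  ... | true  = cong suc (size-+ m (f ∘ suc))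
  ... | false = size-+ m (f ∘ suc)

  size-false : ∀ n → size {n} (λ _ → false) ≡ 0
  size-false zero    = refl
  size-false (suc n) = size-false n

  size-point : (i : Fin k) → size (λ j → does (j ≟ i)) ≡ 1
  size-point {suc k} zero = cong suc (size-false k)
  size-point (suc i) = size-point i

  size-inject : (n≤k : n ≤ k) (i : Fin k) →
    size (λ j → does (inject≤ j n≤k ≟ i)) ≡ 0 ⊎ size (λ j → does (inject≤ j n≤k ≟ i)) ≡ 1
  size-inject {zero}          n≤k       i       = inj₁ refl
  size-inject {suc n} {suc k} (s≤s n≤k) zero    = inj₂ (cong suc (size-false n))
  size-inject {suc n} {suc k} (s≤s n≤k) (suc i) = size-inject n≤k i

  k+/k : ∀ k .{{_ : NonZero k}} n → (k + n) / k ≡ suc (n / k)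
  k+/k k n = trans (+-distrib-/-∣ˡ n (∣-refl {k})) (cong (_+ n / k) (n/n≡1 k))

  ⌈k+/k⌉ : ∀ k .{{_ : NonZero k}} n → ⌈ k + n / k ⌉ ≡ suc ⌈ n / k ⌉
  ⌈k+/k⌉ k n = trans (cong (_/ k) (ℕ.+-assoc k n (pred k))) (k+/k k (n + pred k))

  ⌈small⌉ : ∀ k .{{_ : NonZero k}} n → suc n < k → ⌈ suc n / k ⌉ ≡ 1
  ⌈small⌉ (suc k) n 1+n<k = begin
    (suc n + k) / suc k   ≡⟨ cong (λ x → suc x / suc k) (ℕ.+-comm n k) ⟩
    (suc k + n) / suc k   ≡⟨ k+/k (suc k) n ⟩
    suc (n / suc k)       ≡⟨ cong suc (m<n⇒m/n≡0 (ℕ.<-trans (ℕ.n<1+n n) 1+n<k)) ⟩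
    1                     ∎
    where open ≡-Reasoning

  balanced-small : .{{_ : NonZero k}} → (n<k : n < k) → IsBalanced (λ v → inject≤ v (ℕ.<⇒≤ n<k))
  balanced-small {k} {zero}  n<k i = inj₁ (sym (0/n≡0 k))
  balanced-small {k} {suc n} n<k i = ⊎-map
    (λ eq → trans eq (sym (m<n⇒m/n≡0 n<k)))
    (λ eq → trans eq (sym (⌈small⌉ k n n<k)))
    (size-inject (ℕ.<⇒≤ n<k) i)

  balanced-step : .{{_ : NonZero k}} → (c : Fin n → Fin k) → IsBalanced c →
                  IsBalanced (λ v → [ id , c ]′ (splitAt k {n} v))
  balanced-step {k} {n} c bal i = ⊎-map
    (λ eq → trans size≡ (trans (cong suc eq) (sym (k+/k k n))))
    (λ eq → trans size≡ (trans (cong suc eq) (sym (⌈k+/k⌉ k n))))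
    (bal i)
    where
    size≡ : ∣ part (λ v → [ id , c ]′ (splitAt k {n} v)) i ∣ ≡ suc ∣ part c i ∣
    size≡ = trans (size-+ k _) (cong₂ _+_
      (trans (size-cong λ j → cong (λ s → does ([ id , c ]′ s ≟ i)) (splitAt-↑ˡ k j n))
             (size-point i))
      (size-cong λ j → cong (λ s → does ([ id , c ]′ s ≟ i)) (splitAt-↑ʳ k n j)))

  balanced : ∀ k .{{_ : NonZero k}} n → ∃ λ (c : Fin n → Fin k) → IsBalanced c
  balanced k@(suc _) = <-rec _ go
    where
    go : ∀ n → (∀ {m} → m < n → ∃ λ (c : Fin m → Fin k) → IsBalanced c) →
         ∃ λ (c : Fin n → Fin k) → IsBalanced c
    go n rec with n ℕ.<? k
    ... | yes n<k = (λ v → inject≤ v (ℕ.<⇒≤ n<k)) , balanced-small n<k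
    ... | no  n≮k with ℕ.m≤n⇒∃[o]m+o≡n (ℕ.≮⇒≥ n≮k)
    ...   | o , refl with rec {o} (ℕ.m<n+m o (s≤s z≤n))
    ...     | c , bal = (λ v → [ id , c ]′ (splitAt k v)) , balanced-step c bal

turán-exists : ∀ n k .{{_ : NonZero k}} → ∃ λ (T : Graph n) → IsTurán k T
turán-exists n k =
  let (c , bal) = balanced k n
  in completePartite c , c , (λ u v → mk⇔ id id) , bal

{-# OPTIONS --safe #-}
-- Every copy of H in G is the image of the same positive number of embeddings,
-- so it suffices to compare numbers of embeddings.  Moving a vertex from a larger
-- part to a smaller one does not decrease that number: fix which vertices of H go
-- to the other parts; the remaining ones induce a linear forest in the complete
-- bipartite graph on the two parts, of sizes a and b.  If this forest has e paths
-- of even order and r of odd order, and s is the sum of the ⌊order/2⌋, it has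
-- 2^e (a)ₛ (b)ₛ (a + b - 2s)ᵣ embeddings, with (x)ₛ the falling factorial.  For
-- fixed a + b this grows as a and b approach each other, since (a)ₛ (b)ₛ does.
-- Repeating such moves leads from any sizes to the balanced ones.
module Submission where

open import Data.Bool.Base using (Bool; true; false; T; if_then_else_)
import Data.Bool.Properties as Bool
open import Data.Bool.Properties using (T?)
open import Data.Fin.Base using (Fin; zero; suc; toℕ; fromℕ<; join; splitAt; _↑ˡ_; _↑ʳ_)
open import Data.Fin.Properties using (_≟_; all?; any?; suc-injective; injective⇒≤; toℕ<n; toℕ-↑ˡ; toℕ-↑ʳ; splitAt-↑ˡ; splitAt-↑ʳ; join-splitAt)
open import Data.Fin.Subset using (Subset; ∣_∣) renaming (_∈_ to _∈ˢ_)
open import Data.Fin.Subset.Properties using (⊆-antisym) renaming (_∈?_ to _∈ˢ?_)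
open import Data.List.Base using (List; []; _∷_; _++_; length; filter; map; allFin; cartesianProduct; cartesianProductWith)
import Data.List.Membership.DecPropositional as DecMembership
open import Data.List.Membership.Propositional using (_∈_; _∉_)
open import Data.List.Membership.Propositional.Properties using (∈-allFin; ∈-cartesianProduct⁺; ∈-cartesianProductWith⁺)
open import Data.List.Properties using (map-++; map-∘; map-tabulate; filter-none)
open import Data.List.Relation.Unary.All as All using (All; []; _∷_)
open import Data.List.Relation.Unary.All.Properties using (¬Any⇒All¬)
open import Data.List.Relation.Unary.AllPairs using ([]; _∷_)
open import Data.List.Relation.Unary.Any as Any using (here; there)
open import Data.List.Relation.Unary.Unique.Propositional using (Unique)
open import Data.List.Relation.Unary.Unique.Propositional.Properties using (allFin⁺; cartesianProduct⁺; cartesianProductWith⁺)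
open import Data.Nat.Base
open import Data.Nat.DivMod using (_/_; /-monoˡ-≤; +-distrib-/-∣ʳ; n/n≡1)
open import Data.Nat.Divisibility using (∣-refl)
open import Data.Nat.ListAction using (sum)
open import Data.Nat.ListAction.Properties using (sum-++)
import Data.Nat.Properties as ℕ
open import Data.Nat.Properties hiding (_≟_; suc-injective)
open import Data.Nat.Solver using (module +-*-Solver)
open import Data.Product.Base using (_×_; _,_; proj₁; proj₂; ∃)
import Data.Product.Properties as Product
open import Data.Sum.Base as Sum using (_⊎_; inj₁; inj₂; [_,_]′; swap)
open import Data.Unit.Base using (⊤; tt)
open import Data.Vec.Base as Vec using (Vec; []; _∷_; lookup; tabulate)
import Data.Vec.Properties as Vec
open import Function.Base using (_∘_; id)
open import Function.Bundles using (_⇔_; mk⇔; Equivalence)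
open import Function.Definitions using (Injective)
open import Relation.Binary.Construct.Closure.ReflexiveTransitive using (Star; ε; _◅_; _◅◅_; reverse)
open import Relation.Binary.Definitions using (DecidableEquality)
open import Relation.Binary.PropositionalEquality
open import Relation.Nullary.Decidable using (Dec; yes; no; does; dec-true; dec-false; map′; ¬?; _×-dec_; _⊎-dec_; _→-dec_)
open import Relation.Nullary.Negation using (¬_; contradiction)
open import Relation.Unary using (Decidable)
open import Defs

open +-*-Solver using (solve; _:+_; _:*_; _:=_; con)

-- The closed formula is never evaluated. The shape of the formula is carried through this recursion
-- as an invariant in the two sizes `a` and `b`. The obstacle is a sequence that has just entered
-- the pair of parts: the count after a vertex of the first part need not have the balanced shape,
-- because a run with an odd rest uses one part once more than the other. The counts after the two
-- parts are therefore tracked together in `Alternating`, with the same `s` and `g`, and their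
-- weighted sum at the start of a run is `Symmetrised` again. Fixing which vertices go elsewhere
-- turns into a sum over the branches of the recursion, which is why both invariants have a
-- constructor `plus`.

private
  variable
    A B C : Set
    P Q : Set

-- Indicators and finite sums

𝟙 : Dec P → ℕ
𝟙 (yes _) = 1
𝟙 (no _)  = 0

𝟙-cong : (p? : Dec P) (q? : Dec Q) → (P → Q) → (Q → P) → 𝟙 p? ≡ 𝟙 q?
𝟙-cong (yes p) (yes q) f g = refl
𝟙-cong (yes p) (no ¬q) f g = contradiction (f p) ¬q
𝟙-cong (no ¬p) (yes q) f g = contradiction (g q) ¬p
𝟙-cong (no ¬p) (no ¬q) f g = refl

𝟙-× : (p? : Dec P) (q? : Dec Q) → 𝟙 (p? ×-dec q?) ≡ 𝟙 p? * 𝟙 q?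
𝟙-× (yes _) (yes _) = refl
𝟙-× (yes _) (no _)  = refl
𝟙-× (no _)  _       = refl

𝟙-yes : (p? : Dec P) → P → 𝟙 p? ≡ 1
𝟙-yes (yes _) p = refl
𝟙-yes (no ¬p) p = contradiction p ¬p

𝟙-no : (p? : Dec P) → ¬ P → 𝟙 p? ≡ 0
𝟙-no (yes p) ¬p = contradiction p ¬p
𝟙-no (no _)  ¬p = refl

∑ : List A → (A → ℕ) → ℕ
∑ xs f = sum (map f xs)

∑-cong : ∀ (xs : List A) {f g : A → ℕ} → f ≗ g → ∑ xs f ≡ ∑ xs g
∑-cong []       eq = refl
∑-cong (x ∷ xs) eq = cong₂ _+_ (eq x) (∑-cong xs eq)

∑-zero : ∀ (xs : List A) → ∑ xs (λ _ → 0) ≡ 0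
∑-zero []       = refl
∑-zero (x ∷ xs) = ∑-zero xs

∑-distrib-+ : ∀ (xs : List A) (f g : A → ℕ) → ∑ xs (λ x → f x + g x) ≡ ∑ xs f + ∑ xs g
∑-distrib-+ []       f g = refl
∑-distrib-+ (x ∷ xs) f g rewrite ∑-distrib-+ xs f g =
  solve 4 (λ a b c d → a :+ b :+ (c :+ d) := a :+ c :+ (b :+ d)) refl (f x) (g x) (∑ xs f) (∑ xs g)

*-distribˡ-∑ : ∀ (xs : List A) m (f : A → ℕ) → m * ∑ xs f ≡ ∑ xs (λ x → m * f x)
*-distribˡ-∑ []       m f = *-zeroʳ m
*-distribˡ-∑ (x ∷ xs) m f =
  trans (*-distribˡ-+ m (f x) (∑ xs f)) (cong (m * f x +_) (*-distribˡ-∑ xs m f))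

*-distribʳ-∑ : ∀ (xs : List A) m (f : A → ℕ) → ∑ xs f * m ≡ ∑ xs (λ x → f x * m)
*-distribʳ-∑ xs m f = trans (*-comm (∑ xs f) m)
  (trans (*-distribˡ-∑ xs m f) (∑-cong xs λ x → *-comm m (f x)))

∑-comm : ∀ (xs : List A) (ys : List B) (f : A → B → ℕ) →
         ∑ xs (λ x → ∑ ys (f x)) ≡ ∑ ys (λ y → ∑ xs (λ x → f x y))
∑-comm []       ys f = sym (∑-zero ys)
∑-comm (x ∷ xs) ys f = trans (cong (∑ ys (f x) +_) (∑-comm xs ys f))
  (sym (∑-distrib-+ ys (f x) (λ y → ∑ xs (λ x → f x y))))

∑-mono-≤ : ∀ (xs : List A) {f g : A → ℕ} → (∀ x → f x ≤ g x) → ∑ xs f ≤ ∑ xs g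
∑-mono-≤ []       le = z≤n
∑-mono-≤ (x ∷ xs) le = +-mono-≤ (le x) (∑-mono-≤ xs le)

∑-mono-< : ∀ {xs : List A} {f g : A → ℕ} {x} → (∀ x → f x ≤ g x) → x ∈ xs → f x < g x → ∑ xs f < ∑ xs g
∑-mono-< {xs = _ ∷ xs} le (here refl) lt = +-mono-<-≤ lt (∑-mono-≤ xs le)
∑-mono-< {xs = y ∷ xs} le (there x∈) lt = +-mono-≤-< (le y) (∑-mono-< le x∈ lt)

∑-∈-≤ : ∀ {xs : List A} (f : A → ℕ) {x} → x ∈ xs → f x ≤ ∑ xs f
∑-∈-≤ f (here refl) = m≤m+n _ _
∑-∈-≤ f (there x∈)  = ≤-trans (∑-∈-≤ f x∈) (m≤n+m _ _)

∑-++ : ∀ (xs ys : List A) (f : A → ℕ) → ∑ (xs ++ ys) f ≡ ∑ xs f + ∑ ys f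
∑-++ xs ys f = trans (cong sum (map-++ f xs ys)) (sum-++ (map f xs) (map f ys))

∑-cartesianProductWith : ∀ (_⊗_ : A → B → C) xs ys (f : C → ℕ) →
  ∑ (cartesianProductWith _⊗_ xs ys) f ≡ ∑ xs (λ x → ∑ ys (λ y → f (x ⊗ y)))
∑-cartesianProductWith _⊗_ []       ys f = refl
∑-cartesianProductWith _⊗_ (x ∷ xs) ys f =
  trans (∑-++ (map (x ⊗_) ys) _ f)
        (cong₂ _+_ (cong sum (sym (map-∘ ys))) (∑-cartesianProductWith _⊗_ xs ys f))

length-filter : ∀ {P : A → Set} (P? : Decidable P) xs → length (filter P? xs) ≡ ∑ xs (λ x → 𝟙 (P? x))
length-filter P? []       = refl
length-filter P? (x ∷ xs) with P? x
... | yes _ = cong suc (length-filter P? xs)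
... | no  _ = length-filter P? xs

module _ (_≟ᴬ_ : DecidableEquality A) where

  ∑-absent : ∀ {xs} {z : A} (f : A → ℕ) → All (z ≢_) xs → ∑ xs (λ x → 𝟙 (x ≟ᴬ z) * f x) ≡ 0
  ∑-absent f []              = refl
  ∑-absent {x ∷ _} {z} f (z≢x ∷ z≢xs)
    rewrite 𝟙-no (x ≟ᴬ z) (z≢x ∘ sym) = ∑-absent f z≢xs

  ∑-select : ∀ {xs z} (f : A → ℕ) → Unique xs → z ∈ xs → ∑ xs (λ x → 𝟙 (x ≟ᴬ z) * f x) ≡ f z
  ∑-select {x ∷ xs} f (x∉ ∷ _) (here refl)
    rewrite 𝟙-yes (x ≟ᴬ x) refl | ∑-absent f x∉ =
      trans (+-identityʳ (f x + 0)) (+-identityʳ (f x))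
  ∑-select {x ∷ xs} {z} f (x∉ ∷ u) (there z∈)
    rewrite 𝟙-no (x ≟ᴬ z) (λ x≡z → All.lookup x∉ z∈ x≡z) = ∑-select f u z∈

  -- Both sums count the pairs (`x`, `y`) in the graph of the correspondence, once by `x` and once
  -- by `y`. The maps are inverse to each other only on `P` and `Q`, since transporting tuples
  -- between two copies is invertible only on those that trace a copy.
  ∑-bijection : ∀ {P Q : A → Set} (P? : Decidable P) (Q? : Decidable Q) (φ ψ : A → A) →
    (∀ {x} → P x → Q (φ x) × ψ (φ x) ≡ x) → (∀ {y} → Q y → P (ψ y) × φ (ψ y) ≡ y) →
    ∀ {xs} → Unique xs → (∀ x → x ∈ xs) → ∑ xs (λ x → 𝟙 (P? x)) ≡ ∑ xs (λ y → 𝟙 (Q? y))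
  ∑-bijection {P} {Q} P? Q? φ ψ to from {xs} u all∈ = begin
    ∑ xs (λ x → 𝟙 (P? x))
      ≡⟨ ∑-cong xs (λ x → sym (∑-select (λ _ → 𝟙 (P? x)) u (all∈ (φ x)))) ⟩
    ∑ xs (λ x → ∑ xs (λ y → 𝟙 (y ≟ᴬ φ x) * 𝟙 (P? x)))
      ≡⟨ ∑-comm xs xs _ ⟩
    ∑ xs (λ y → ∑ xs (λ x → 𝟙 (y ≟ᴬ φ x) * 𝟙 (P? x)))
      ≡⟨ ∑-cong xs (λ y → ∑-cong xs λ x → flip x y) ⟩
    ∑ xs (λ y → ∑ xs (λ x → 𝟙 (x ≟ᴬ ψ y) * 𝟙 (Q? y)))
      ≡⟨ ∑-cong xs (λ y → ∑-select (λ _ → 𝟙 (Q? y)) u (all∈ (ψ y))) ⟩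
    ∑ xs (λ y → 𝟙 (Q? y)) ∎
    where
    open ≡-Reasoning
    flip : ∀ x y → 𝟙 (y ≟ᴬ φ x) * 𝟙 (P? x) ≡ 𝟙 (x ≟ᴬ ψ y) * 𝟙 (Q? y)
    flip x y = begin
      𝟙 (y ≟ᴬ φ x) * 𝟙 (P? x)        ≡⟨ 𝟙-× (y ≟ᴬ φ x) (P? x) ⟨
      𝟙 ((y ≟ᴬ φ x) ×-dec P? x)
        ≡⟨ 𝟙-cong ((y ≟ᴬ φ x) ×-dec P? x) ((x ≟ᴬ ψ y) ×-dec Q? y)
             (λ { (refl , p) → sym (proj₂ (to p)) , proj₁ (to p) })
             (λ { (refl , q) → sym (proj₂ (from q)) , proj₁ (from q) }) ⟩
      𝟙 ((x ≟ᴬ ψ y) ×-dec Q? y)      ≡⟨ 𝟙-× (x ≟ᴬ ψ y) (Q? y) ⟩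
      𝟙 (x ≟ᴬ ψ y) * 𝟙 (Q? y)        ∎

-- Enumeration of vectors

allVecs-∈ : ∀ {xs : List A} → (∀ x → x ∈ xs) → ∀ {m} (v : Vec A m) → v ∈ allVecs xs m
allVecs-∈ all∈ []      = here refl
allVecs-∈ all∈ (x ∷ v) = ∈-cartesianProductWith⁺ _∷_ (all∈ x) (allVecs-∈ all∈ v)

allVecs-unique : ∀ {xs : List A} → Unique xs → ∀ m → Unique (allVecs xs m)
allVecs-unique u zero    = [] ∷ []
allVecs-unique u (suc m) = cartesianProductWith⁺ _∷_ Vec.∷-injective u (allVecs-unique u m)

-- Falling factorials

_↓_ : ℕ → ℕ → ℕ
a ↓ zero  = 1
a ↓ suc s = a * (pred a ↓ s)

infix 8 _↓_

-- The definition splits off the largest factor, as choosing a vertex does; comparing products needs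
-- the smallest one. Truncation is harmless: for `a < s` the factor `a ↓ s` already vanishes.
↓-suc : ∀ a s → a ↓ suc s ≡ a ↓ s * (a ∸ s)
↓-suc a zero    = *-comm a 1
↓-suc a (suc s) = begin
  a * (pred a ↓ suc s)              ≡⟨ cong (a *_) (↓-suc (pred a) s) ⟩
  a * (pred a ↓ s * (pred a ∸ s))   ≡⟨ *-assoc a _ _ ⟨
  a * pred a ↓ s * (pred a ∸ s)     ≡⟨ cong (a * pred a ↓ s *_) (∸-+-assoc a 1 s) ⟩
  a * pred a ↓ s * (a ∸ suc s)      ∎
  where open ≡-Reasoning

↓-zero : ∀ {a s} → a < s → a ↓ s ≡ 0
↓-zero {zero}  {suc s} _         = refl
↓-zero {suc a} {suc s} (s≤s a<s) = trans (cong (suc a *_) (↓-zero a<s)) (*-zeroʳ a)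

-- If a < s or b < s, both sides vanish, so the truncated differences are harmless.
↓-∸-+ : ∀ a b s → a ↓ s * b ↓ s * ((a ∸ s) + (b ∸ s)) ≡ a ↓ s * b ↓ s * (a + b ∸ (s + s))
↓-∸-+ a b s with s ≤? a | s ≤? b
... | no s≰a  | _       rewrite ↓-zero (≰⇒> s≰a) = refl
... | yes _   | no s≰b  rewrite ↓-zero (≰⇒> s≰b) | *-zeroʳ (a ↓ s) = refl
... | yes s≤a | yes s≤b = cong (a ↓ s * b ↓ s *_) (begin
  (a ∸ s) + (b ∸ s)   ≡⟨ +-∸-assoc (a ∸ s) s≤b ⟨
  (a ∸ s) + b ∸ s     ≡⟨ cong (_∸ s) (+-∸-comm b s≤a) ⟨
  (a + b ∸ s) ∸ s     ≡⟨ ∸-+-assoc (a + b) s s ⟩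
  a + b ∸ (s + s)     ∎)
  where open ≡-Reasoning

-- This is the monotonicity of (x - r) / (x + 1) = 1 - (r + 1) / (x + 1), with denominators cleared.
↓-cross : ∀ {q p} r → q ≤ p → suc p * (q ∸ r) ≤ (p ∸ r) * suc q
↓-cross {q} {p} r q≤p with r ≤? q
... | no r≰q rewrite m≤n⇒m∸n≡0 (<⇒≤ (≰⇒> r≰q)) | *-zeroʳ p = z≤n
... | yes r≤q with m≤n⇒∃[o]m+o≡n r≤q | m≤n⇒∃[o]m+o≡n q≤p
...   | d , refl | e , refl
  rewrite m+n∸m≡n r d | +-assoc r d e | m+n∸m≡n r (d + e) =
  -- The two sides differ by exactly (r + 1)(p - q), and `e` is p - q.
  ≤-trans (m≤m+n _ (e + e * r)) (≤-reflexive
    (solve 3 (λ r d e → (con 1 :+ (r :+ (d :+ e))) :* d :+ (e :+ e :* r)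
                     := (d :+ e) :* (con 1 :+ (r :+ d))) refl r d e))

-- With s = r + 1, both sides share the factor `p ↓ r * q ↓ r`; what remains on each side is the
-- pair of factors compared in `↓-cross`.
↓-balance : ∀ {q p} s → q ≤ p → suc p ↓ s * q ↓ s ≤ p ↓ s * suc q ↓ s
↓-balance zero            q≤p = ≤-refl
↓-balance {q} {p} (suc r) q≤p = begin
  suc p * p ↓ r * q ↓ suc r                  ≡⟨ cong (suc p * p ↓ r *_) (↓-suc q r) ⟩
  suc p * p ↓ r * (q ↓ r * (q ∸ r))          ≡⟨ rearrange₁ (suc p) (p ↓ r) (q ↓ r) (q ∸ r) ⟩
  p ↓ r * q ↓ r * (suc p * (q ∸ r))          ≤⟨ *-monoʳ-≤ (p ↓ r * q ↓ r) (↓-cross r q≤p) ⟩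
  p ↓ r * q ↓ r * ((p ∸ r) * suc q)          ≡⟨ rearrange₂ (p ↓ r) (q ↓ r) (p ∸ r) (suc q) ⟩
  p ↓ r * (p ∸ r) * (suc q * q ↓ r)          ≡⟨ cong (_* (suc q * q ↓ r)) (↓-suc p r) ⟨
  p ↓ suc r * (suc q * q ↓ r)                ∎
  where
  open ≤-Reasoning
  rearrange₁ : ∀ a b c d → a * b * (c * d) ≡ b * c * (a * d)
  rearrange₁ = solve 4 (λ a b c d → a :* b :* (c :* d) := b :* c :* (a :* d)) refl
  rearrange₂ : ∀ a b c d → a * b * (c * d) ≡ a * c * (d * b)
  rearrange₂ = solve 4 (λ a b c d → a :* b :* (c :* d) := a :* c :* (d :* b)) refl

-- Counts as functions of two part sizes

-- As a function of two part sizes a and b, the number of continuations of a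
-- sequence whose next vertex is not linked to a vertex of these two parts.
data Symmetrised (f : ℕ → ℕ → ℕ) : Set where
  term : ∀ s (g : ℕ → ℕ) → (∀ a b → f a b ≡ a ↓ s * b ↓ s * g (a + b)) → Symmetrised f
  plus : ∀ {f₁ f₂} → Symmetrised f₁ → Symmetrised f₂ →
         (∀ a b → f a b ≡ f₁ a b + f₂ a b) → Symmetrised f

-- The numbers of continuations after a vertex of the first, respectively second,
-- of two parts: the rest of the current alternating run has even or odd length.
data Alternating (f₁ f₂ : ℕ → ℕ → ℕ) : Set where
  even : ∀ s (g : ℕ → ℕ) → (∀ a b → f₁ a b ≡ a ↓ s * b ↓ s * g (a + b)) →
         (∀ a b → f₂ a b ≡ a ↓ s * b ↓ s * g (a + b)) → Alternating f₁ f₂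
  odd  : ∀ s (g : ℕ → ℕ) → (∀ a b → f₁ a b ≡ a ↓ s * b ↓ suc s * g (a + b)) →
         (∀ a b → f₂ a b ≡ a ↓ suc s * b ↓ s * g (a + b)) → Alternating f₁ f₂
  plus : ∀ {g₁ g₂ h₁ h₂} → Alternating g₁ g₂ → Alternating h₁ h₂ →
         (∀ a b → f₁ a b ≡ g₁ a b + h₁ a b) → (∀ a b → f₂ a b ≡ g₂ a b + h₂ a b) →
         Alternating f₁ f₂

symmetrised-balance : ∀ {f} → Symmetrised f → ∀ {p q} → q < p → f p q ≤ f (pred p) (suc q)
symmetrised-balance {f} (term s g eq) {suc p} {q} (s≤s q≤p) = begin
  f (suc p) q                            ≡⟨ eq (suc p) q ⟩
  suc p ↓ s * q ↓ s * g (suc p + q)      ≤⟨ *-monoˡ-≤ (g (suc p + q)) (↓-balance s q≤p) ⟩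
  p ↓ s * suc q ↓ s * g (suc p + q)      ≡⟨ cong (λ z → p ↓ s * suc q ↓ s * g z) (+-suc p q) ⟨
  p ↓ s * suc q ↓ s * g (p + suc q)      ≡⟨ eq p (suc q) ⟨
  f p (suc q)                            ∎
  where open ≤-Reasoning
symmetrised-balance (plus S₁ S₂ eq) {p} {q} q<p =
  subst₂ _≤_ (sym (eq p q)) (sym (eq (pred p) (suc q)))
    (+-mono-≤ (symmetrised-balance S₁ q<p) (symmetrised-balance S₂ q<p))

symmetrised-cong : ∀ {f f′} → (∀ a b → f′ a b ≡ f a b) → Symmetrised f → Symmetrised f′
symmetrised-cong e (term s g eq)   = term s g (λ a b → trans (e a b) (eq a b))
symmetrised-cong e (plus S₁ S₂ eq) = plus S₁ S₂ (λ a b → trans (e a b) (eq a b))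

symmetrised-0 : Symmetrised (λ _ _ → 0)
symmetrised-0 = term 0 (λ _ → 0) λ a b → refl

symmetrised-* : ∀ {f} m → Symmetrised f → Symmetrised (λ a b → m * f a b)
symmetrised-* m (term s g eq)   = term s (λ z → m * g z) λ a b →
  trans (cong (m *_) (eq a b))
        (solve 4 (λ m x y z → m :* (x :* y :* z) := x :* y :* (m :* z)) refl m (a ↓ s) (b ↓ s) (g (a + b)))
symmetrised-* m (plus S₁ S₂ eq) = plus (symmetrised-* m S₁) (symmetrised-* m S₂) λ a b →
  trans (cong (m *_) (eq a b)) (*-distribˡ-+ m _ _)

symmetrised-∑ : ∀ {A : Set} (xs : List A) {f : A → ℕ → ℕ → ℕ} → (∀ x → Symmetrised (f x)) →
                Symmetrised (λ a b → ∑ xs (λ x → f x a b))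
symmetrised-∑ []       S = symmetrised-0
symmetrised-∑ (x ∷ xs) S = plus (S x) (symmetrised-∑ xs S) λ a b → refl

-- A run that stops at the current vertex has a rest of length zero, which is even, and what follows
-- does not depend on the part in which it stopped.
symmetrised⇒alternating : ∀ {f} → Symmetrised f → Alternating f f
symmetrised⇒alternating (term s g eq)   = even s g eq eq
symmetrised⇒alternating (plus S₁ S₂ eq) =
  plus (symmetrised⇒alternating S₁) (symmetrised⇒alternating S₂) eq eq

-- The arguments of `g` differ only for `a = 0`, where the factor `a` makes both sides vanish.
pred-+ˡ : ∀ a b (g : ℕ → ℕ) → a * g (pred a + b) ≡ a * g (pred (a + b))
pred-+ˡ zero    b g = refl
pred-+ˡ (suc a) b g = refl

pred-+ʳ : ∀ a b (g : ℕ → ℕ) → b * g (a + pred b) ≡ b * g (pred (a + b))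
pred-+ʳ a b g rewrite +-comm a (pred b) | +-comm a b = pred-+ˡ b a g

pull-first : ∀ a b x y (g : ℕ → ℕ) → a * (x * y * g (pred a + b)) ≡ (a * x) * y * g (pred (a + b))
pull-first a b x y g = begin
  a * (x * y * g (pred a + b))   ≡⟨ solve 4 (λ a x y z → a :* (x :* y :* z) := x :* y :* (a :* z)) refl a x y _ ⟩
  x * y * (a * g (pred a + b))   ≡⟨ cong (x * y *_) (pred-+ˡ a b g) ⟩
  x * y * (a * g (pred (a + b))) ≡⟨ solve 4 (λ a x y z → x :* y :* (a :* z) := a :* x :* y :* z) refl a x y _ ⟩
  a * x * y * g (pred (a + b))   ∎
  where open ≡-Reasoning

pull-second : ∀ a b x y (g : ℕ → ℕ) → b * (x * y * g (a + pred b)) ≡ x * (b * y) * g (pred (a + b))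
pull-second a b x y g = begin
  b * (x * y * g (a + pred b))   ≡⟨ solve 4 (λ a x y z → a :* (x :* y :* z) := x :* y :* (a :* z)) refl b x y _ ⟩
  x * y * (b * g (a + pred b))   ≡⟨ cong (x * y *_) (pred-+ʳ a b g) ⟩
  x * y * (b * g (pred (a + b))) ≡⟨ solve 4 (λ b x y z → x :* y :* (b :* z) := x :* (b :* y) :* z) refl b x y _ ⟩
  x * (b * y) * g (pred (a + b)) ∎
  where open ≡-Reasoning

-- An even rest gives a run of odd order, whose unpaired vertex has (a - s) + (b - s) choices over
-- both starting parts, a function of `a + b`. An odd rest gives a run of even order, with the same
-- count from either starting part, hence the factor 2. The `pred` under `g` accounts for the vertex
-- just chosen.
alternating-start : ∀ {f₁ f₂} → Alternating f₁ f₂ →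
                    Symmetrised (λ a b → a * f₁ (pred a) b + b * f₂ a (pred b))
alternating-start {f₁} {f₂} (even s g eq₁ eq₂) =
  term s (λ z → (z ∸ (s + s)) * g (pred z)) λ a b → begin
    a * f₁ (pred a) b + b * f₂ a (pred b)
      ≡⟨ cong₂ (λ x y → a * x + b * y) (eq₁ (pred a) b) (eq₂ a (pred b)) ⟩
    a * (pred a ↓ s * b ↓ s * g (pred a + b)) + b * (a ↓ s * pred b ↓ s * g (a + pred b))
      ≡⟨ cong₂ _+_ (pull-first a b (pred a ↓ s) (b ↓ s) g) (pull-second a b (a ↓ s) (pred b ↓ s) g) ⟩
    a ↓ suc s * b ↓ s * g (pred (a + b)) + a ↓ s * b ↓ suc s * g (pred (a + b))
      ≡⟨ cong₂ (λ x y → x * b ↓ s * g (pred (a + b)) + a ↓ s * y * g (pred (a + b))) (↓-suc a s) (↓-suc b s) ⟩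
    a ↓ s * (a ∸ s) * b ↓ s * g (pred (a + b)) + a ↓ s * (b ↓ s * (b ∸ s)) * g (pred (a + b))
      ≡⟨ solve 5 (λ x y u v z → x :* u :* y :* z :+ x :* (y :* v) :* z := x :* y :* (u :+ v) :* z) refl
           (a ↓ s) (b ↓ s) (a ∸ s) (b ∸ s) (g (pred (a + b))) ⟩
    a ↓ s * b ↓ s * ((a ∸ s) + (b ∸ s)) * g (pred (a + b))
      ≡⟨ cong (_* g (pred (a + b))) (↓-∸-+ a b s) ⟩
    a ↓ s * b ↓ s * (a + b ∸ (s + s)) * g (pred (a + b))
      ≡⟨ *-assoc (a ↓ s * b ↓ s) _ _ ⟩
    a ↓ s * b ↓ s * ((a + b ∸ (s + s)) * g (pred (a + b))) ∎
  where open ≡-Reasoning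
alternating-start {f₁} {f₂} (odd s g eq₁ eq₂) =
  term (suc s) (λ z → 2 * g (pred z)) λ a b → begin
    a * f₁ (pred a) b + b * f₂ a (pred b)
      ≡⟨ cong₂ (λ x y → a * x + b * y) (eq₁ (pred a) b) (eq₂ a (pred b)) ⟩
    a * (pred a ↓ s * b ↓ suc s * g (pred a + b)) + b * (a ↓ suc s * pred b ↓ s * g (a + pred b))
      ≡⟨ cong₂ _+_ (pull-first a b (pred a ↓ s) (b ↓ suc s) g) (pull-second a b (a ↓ suc s) (pred b ↓ s) g) ⟩
    a ↓ suc s * b ↓ suc s * g (pred (a + b)) + a ↓ suc s * b ↓ suc s * g (pred (a + b))
      ≡⟨ solve 3 (λ x y z → x :* y :* z :+ x :* y :* z := x :* y :* (con 2 :* z)) refl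
           (a ↓ suc s) (b ↓ suc s) (g (pred (a + b))) ⟩
    a ↓ suc s * b ↓ suc s * (2 * g (pred (a + b))) ∎
  where open ≡-Reasoning
alternating-start {f₁} {f₂} (plus {g₁} {g₂} {h₁} {h₂} A₁ A₂ eq₁ eq₂) =
  plus (alternating-start A₁) (alternating-start A₂) λ a b →
    trans (cong₂ (λ x y → a * x + b * y) (eq₁ (pred a) b) (eq₂ a (pred b)))
      (solve 6 (λ a b x y u v → a :* (x :+ y) :+ b :* (u :+ v) := a :* x :+ b :* u :+ (a :* y :+ b :* v))
        refl a b (g₁ (pred a) b) (h₁ (pred a) b) (g₂ a (pred b)) (h₂ a (pred b)))

-- A linked vertex inside the pair lies in the opposite part, so the two counts change places. One
-- more vertex flips the parity of the rest, and every second flip completes a pair and raises `s`.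
alternating-continue : ∀ {f₁ f₂} → Alternating f₁ f₂ →
                       Alternating (λ a b → b * f₂ a (pred b)) (λ a b → a * f₁ (pred a) b)
alternating-continue (even s g eq₁ eq₂) = odd s (g ∘ pred)
  (λ a b → trans (cong (b *_) (eq₂ a (pred b))) (pull-second a b (a ↓ s) (pred b ↓ s) g))
  (λ a b → trans (cong (a *_) (eq₁ (pred a) b)) (pull-first a b (pred a ↓ s) (b ↓ s) g))
alternating-continue (odd s g eq₁ eq₂) = even (suc s) (g ∘ pred)
  (λ a b → trans (cong (b *_) (eq₂ a (pred b))) (pull-second a b (a ↓ suc s) (pred b ↓ s) g))
  (λ a b → trans (cong (a *_) (eq₁ (pred a) b)) (pull-first a b (pred a ↓ s) (b ↓ suc s) g))
alternating-continue (plus A₁ A₂ eq₁ eq₂) =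
  plus (alternating-continue A₁) (alternating-continue A₂)
    (λ a b → trans (cong (b *_) (eq₂ a (pred b))) (*-distribˡ-+ b _ _))
    (λ a b → trans (cong (a *_) (eq₁ (pred a) b)) (*-distribˡ-+ a _ _))

-- Sequences of distinct vertices in a complete multipartite graph

private
  1*-cancel : ∀ {m} → m ≡ 1 → ∀ n → m * n ≡ n
  1*-cancel refl n = *-identityˡ n

  0*-cancel : ∀ {m} → m ≡ 0 → ∀ n → m * n ≡ 0
  0*-cancel refl n = refl

module _ {k : ℕ} where

  decr : Fin k → (Fin k → ℕ) → Fin k → ℕ
  decr y a z = a z ∸ 𝟙 (z ≟ y)

  link : Bool → Fin k → Fin k → ℕ
  link l x y = 𝟙 (¬? (T? l ×-dec (x ≟ y)))

  -- The number of ways to choose m further distinct vertices when a y vertices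
  -- of part y are unused.  Here b i says whether the i-th chosen vertex is linked
  -- to the next one, and l whether the first is linked to a predecessor in part x.
  sequences : Bool → (ℕ → Bool) → ℕ → Fin k → (Fin k → ℕ) → ℕ
  sequences l b zero    x a = 1
  sequences l b (suc m) x a =
    ∑ (allFin k) (λ y → link l x y * (a y * sequences (b 0) (b ∘ suc) m y (decr y a)))

  sequences-cong : ∀ l b m x {a a′} → a ≗ a′ → sequences l b m x a ≡ sequences l b m x a′
  sequences-cong l b zero    x eq = refl
  sequences-cong l b (suc m) x eq = ∑-cong (allFin k) λ y → cong (link l x y *_)
    (cong₂ _*_ (eq y) (sequences-cong (b 0) (b ∘ suc) m y λ z → cong (_∸ 𝟙 (z ≟ y)) (eq z)))

  -- Dependence of the count on two part sizes

  module _ {i j : Fin k} (i≢j : i ≢ j) where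

    -- Frees the sizes at `i` and `j`, making a count a function of two numbers with the other sizes
    -- as parameters.
    resize : (Fin k → ℕ) → ℕ → ℕ → Fin k → ℕ
    resize a p q z with z ≟ i | z ≟ j
    ... | yes _ | _     = p
    ... | no  _ | yes _ = q
    ... | no  _ | no  _ = a z

    resize-i : ∀ a p q → resize a p q i ≡ p
    resize-i a p q with i ≟ i | i ≟ j
    ... | yes _   | _ = refl
    ... | no  i≢i | _ = contradiction refl i≢i

    resize-j : ∀ a p q → resize a p q j ≡ q
    resize-j a p q with j ≟ i | j ≟ j
    ... | yes j≡i | _       = contradiction (sym j≡i) i≢j
    ... | no  _   | yes _   = refl
    ... | no  _   | no  j≢j = contradiction refl j≢j

    resize-other : ∀ a p q {y} → y ≢ i → y ≢ j → resize a p q y ≡ a y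
    resize-other a p q {y} y≢i y≢j with y ≟ i | y ≟ j
    ... | yes y≡i | _       = contradiction y≡i y≢i
    ... | no  _   | yes y≡j = contradiction y≡j y≢j
    ... | no  _   | no  _   = refl

    decr-resize-i : ∀ a p q → decr i (resize a p q) ≗ resize a (pred p) q
    decr-resize-i a p q z with z ≟ i | z ≟ j
    ... | yes _ | _     = refl
    ... | no  _ | yes _ = refl
    ... | no  _ | no  _ = refl

    decr-resize-j : ∀ a p q → decr j (resize a p q) ≗ resize a p (pred q)
    decr-resize-j a p q z with z ≟ i | z ≟ j
    ... | yes z≡i | yes z≡j = contradiction (trans (sym z≡i) z≡j) i≢j
    ... | yes _   | no _    = refl
    ... | no  _   | yes _   = refl
    ... | no  _   | no  _   = refl

    decr-resize-other : ∀ a p q {y} → y ≢ i → y ≢ j → decr y (resize a p q) ≗ resize (decr y a) p q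
    decr-resize-other a p q {y} y≢i y≢j z with z ≟ i | z ≟ j
    ... | yes refl | _        = cong (p ∸_) (𝟙-no (i ≟ y) (y≢i ∘ sym))
    ... | no  _    | yes refl = cong (q ∸_) (𝟙-no (j ≟ y) (y≢j ∘ sym))
    ... | no  _    | no  _    = refl

    others : Fin k → ℕ
    others y = 𝟙 (¬? (y ≟ i) ×-dec ¬? (y ≟ j))

    ∑-split : (f : Fin k → ℕ) → ∑ (allFin k) f ≡ f i + f j + ∑ (allFin k) (λ y → others y * f y)
    ∑-split f = begin
      ∑ ys f
        ≡⟨ ∑-cong ys pointwise ⟩
      ∑ ys (λ y → 𝟙 (y ≟ i) * f y + 𝟙 (y ≟ j) * f y + others y * f y)
        ≡⟨ ∑-distrib-+ ys _ _ ⟩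
      ∑ ys (λ y → 𝟙 (y ≟ i) * f y + 𝟙 (y ≟ j) * f y) + ∑ ys (λ y → others y * f y)
        ≡⟨ cong (_+ ∑ ys (λ y → others y * f y)) (∑-distrib-+ ys _ _) ⟩
      ∑ ys (λ y → 𝟙 (y ≟ i) * f y) + ∑ ys (λ y → 𝟙 (y ≟ j) * f y) + ∑ ys (λ y → others y * f y)
        ≡⟨ cong₂ (λ u v → u + v + ∑ ys (λ y → others y * f y))
             (∑-select _≟_ f (allFin⁺ k) (∈-allFin i)) (∑-select _≟_ f (allFin⁺ k) (∈-allFin j)) ⟩
      f i + f j + ∑ ys (λ y → others y * f y) ∎
      where
      open ≡-Reasoning
      ys = allFin k
      pointwise : ∀ y → f y ≡ 𝟙 (y ≟ i) * f y + 𝟙 (y ≟ j) * f y + others y * f y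
      pointwise y with y ≟ i | y ≟ j
      ... | yes refl | yes i≡j = contradiction i≡j i≢j
      ... | yes _    | no _    = sym (trans (+-identityʳ _) (trans (+-identityʳ _) (*-identityˡ (f y))))
      ... | no _     | yes _   = sym (trans (+-identityʳ _) (*-identityˡ (f y)))
      ... | no _     | no _    = sym (*-identityˡ (f y))

    others-cong : ∀ y {m n} → (y ≢ i → y ≢ j → m ≡ n) → others y * m ≡ others y * n
    others-cong y eq with y ≟ i | y ≟ j
    ... | yes _   | _       = refl
    ... | no _    | yes _   = refl
    ... | no y≢i  | no y≢j  = cong (1 *_) (eq y≢i y≢j)

    link-refl : ∀ x → link true x x ≡ 0
    link-refl x = 𝟙-no (¬? (T? true ×-dec (x ≟ x))) (λ ne → ne (_ , refl))

    link-≢ : ∀ l {x y} → x ≢ y → link l x y ≡ 1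
    link-≢ l {x} {y} x≢y = 𝟙-yes (¬? (T? l ×-dec (x ≟ y))) (λ (_ , eq) → x≢y eq)

    module _ (l : Bool) (b : ℕ → Bool) (m : ℕ) (a : Fin k → ℕ) where

      private
        rest : Fin k → (Fin k → ℕ) → ℕ
        rest = sequences (b 0) (b ∘ suc) m

        tail : Fin k → ℕ → ℕ → ℕ
        tail x p q = ∑ (allFin k) (λ y → others y * (link l x y * (a y * rest y (resize (decr y a) p q))))

      -- The next vertex lies in part `i`, in part `j` or elsewhere. In the last case `p` and `q`
      -- survive while `a` shrinks, so later hypotheses must range over all `a`.
      sequences-split : ∀ x p q → sequences l b (suc m) x (resize a p q) ≡
        link l x i * (p * rest i (resize a (pred p) q)) +
        link l x j * (q * rest j (resize a p (pred q))) + tail x p q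
      sequences-split x p q = trans (∑-split _) (cong₂ _+_ (cong₂ _+_
        (cong (link l x i *_) (cong₂ _*_ (resize-i a p q)
          (sequences-cong (b 0) (b ∘ suc) m i (decr-resize-i a p q))))
        (cong (link l x j *_) (cong₂ _*_ (resize-j a p q)
          (sequences-cong (b 0) (b ∘ suc) m j (decr-resize-j a p q)))))
        (∑-cong (allFin k) λ y → others-cong y λ y≢i y≢j → cong (link l x y *_)
          (cong₂ _*_ (resize-other a p q y≢i y≢j)
            (sequences-cong (b 0) (b ∘ suc) m y (decr-resize-other a p q y≢i y≢j)))))

      module _ (others-sym : ∀ y → y ≢ i → y ≢ j → ∀ a → Symmetrised (λ p q → rest y (resize a p q)))
               (pair-alt : Alternating (λ p q → rest i (resize a p q)) (λ p q → rest j (resize a p q)))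
        where

        tail-symmetrised : ∀ x → Symmetrised (tail x)
        tail-symmetrised x = symmetrised-∑ (allFin k) λ y → summand y
          where
          summand : ∀ y → Symmetrised (λ p q → others y * (link l x y * (a y * rest y (resize (decr y a) p q))))
          summand y with y ≟ i | y ≟ j
          ... | yes _  | _      = symmetrised-0
          ... | no _   | yes _  = symmetrised-0
          ... | no y≢i | no y≢j = symmetrised-* 1 (symmetrised-* (link l x y)
                                    (symmetrised-* (a y) (others-sym y y≢i y≢j (decr y a))))

        step-symmetrised : ∀ x → link l x i ≡ 1 → link l x j ≡ 1 →
          Symmetrised (λ p q → sequences l b (suc m) x (resize a p q))
        step-symmetrised x li lj = plus (alternating-start pair-alt) (tail-symmetrised x) λ p q →
          trans (sequences-split x p q)
            (cong (_+ tail x p q) (cong₂ _+_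
              (1*-cancel li _) (1*-cancel lj _)))

        -- A vertex outside the pair satisfies the link condition whether its predecessor lies in
        -- `i` or in `j`.
        tail-cong : ∀ p q → tail j p q ≡ tail i p q
        tail-cong p q = ∑-cong (allFin k) λ y → others-cong y λ y≢i y≢j →
          trans (1*-cancel (link-≢ l (y≢j ∘ sym)) _) (sym (1*-cancel (link-≢ l (y≢i ∘ sym)) _))

    -- A link from one part of the pair forbids that part: the next vertex lies in the other one and
    -- prolongs the run, or lies outside the pair and ends it. The latter contribution is the same
    -- after `i` and after `j`.
    step-alternating : ∀ l b m a →
      (∀ y → y ≢ i → y ≢ j → ∀ a → Symmetrised (λ p q → sequences (b 0) (b ∘ suc) m y (resize a p q))) →
      Alternating (λ p q → sequences (b 0) (b ∘ suc) m i (resize a p q))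
                  (λ p q → sequences (b 0) (b ∘ suc) m j (resize a p q)) →
      Alternating (λ p q → sequences l b (suc m) i (resize a p q))
                  (λ p q → sequences l b (suc m) j (resize a p q))
    step-alternating false b m a S A =
      -- Without a link the part of the predecessor drops out by computation, so the counts after
      -- `i` and after `j` are definitionally the same function.
      symmetrised⇒alternating (step-symmetrised false b m a S A i refl refl)
    step-alternating true b m a S A =
      plus (alternating-continue A) (symmetrised⇒alternating (tail-symmetrised true b m a S A i))
        (λ p q → trans (sequences-split true b m a i p q) (cong₂ _+_
          (cong₂ _+_ (0*-cancel (link-refl i) _) (1*-cancel (link-≢ true i≢j) _)) refl))
        (λ p q → trans (sequences-split true b m a j p q) (cong₂ _+_
          (trans (cong₂ _+_ (1*-cancel (link-≢ true (i≢j ∘ sym)) _) (0*-cancel (link-refl j) _))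
                 (+-identityʳ _))
          (tail-cong true b m a S A p q)))

    mutual
      -- The two `link` conditions cover an unlinked first vertex as well as a predecessor outside
      -- the pair. The inductions are entangled because a sequence may enter and leave the pair
      -- repeatedly.
      sequences-symmetrised : ∀ l b m x → link l x i ≡ 1 → link l x j ≡ 1 → ∀ a →
        Symmetrised (λ p q → sequences l b m x (resize a p q))
      sequences-symmetrised l b zero    x li lj a = term 0 (λ _ → 1) λ _ _ → refl
      sequences-symmetrised l b (suc m) x li lj a = step-symmetrised l b m a
        (λ y y≢i y≢j → sequences-symmetrised (b 0) (b ∘ suc) m y (link-≢ (b 0) y≢i) (link-≢ (b 0) y≢j))
        (sequences-alternating (b 0) (b ∘ suc) m a) x li lj

      sequences-alternating : ∀ l b m a → Alternating (λ p q → sequences l b m i (resize a p q))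
                                                      (λ p q → sequences l b m j (resize a p q))
      sequences-alternating l b zero    a = even 0 (λ _ → 1) (λ _ _ → refl) (λ _ _ → refl)
      sequences-alternating l b (suc m) a = step-alternating l b m a
        (λ y y≢i y≢j → sequences-symmetrised (b 0) (b ∘ suc) m y (link-≢ (b 0) y≢i) (link-≢ (b 0) y≢j))
        (sequences-alternating (b 0) (b ∘ suc) m a)

    resize-self : ∀ a → resize a (a i) (a j) ≗ a
    resize-self a z with z ≟ i | z ≟ j
    ... | yes refl | _        = refl
    ... | no _     | yes refl = refl
    ... | no _     | no _     = refl

    sequences-move : ∀ b m x a → a j < a i →
      sequences false b m x a ≤ sequences false b m x (resize a (pred (a i)) (suc (a j)))
    sequences-move b m x a lt = begin
      sequences false b m x a                             ≡⟨ sequences-cong false b m x (resize-self a) ⟨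
      sequences false b m x (resize a (a i) (a j))        ≤⟨ symmetrised-balance (sequences-symmetrised false b m x refl refl a) lt ⟩
      sequences false b m x (resize a (pred (a i)) (suc (a j))) ∎
      where open ≤-Reasoning

-- Reaching balanced sizes by single moves

pred-∸-< : ∀ {t p} → t < p → pred p ∸ t < p ∸ t
pred-∸-< {p = suc p} (s≤s t≤p) = ∸-monoˡ-< (n<1+n p) t≤p

module _ {k : ℕ} (F : (Fin k → ℕ) → ℕ) (F-cong : ∀ {a a′} → a ≗ a′ → F a ≡ F a′)
         (F-move : ∀ {i j} (i≢j : i ≢ j) a → a j < a i → F a ≤ F (resize i≢j a (pred (a i)) (suc (a j))))
         (t : Fin k → ℕ) (t-balanced : ∀ i j → t i ≤ suc (t j)) where

  private
    total : (Fin k → ℕ) → ℕ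
    total = ∑ (allFin k)

    -- The termination measure: when the totals agree, it is half the sum of the distances between
    -- `a y` and `t y`.
    excess : (Fin k → ℕ) → ℕ
    excess a = total (λ y → a y ∸ t y)

    total-move : ∀ {i j} (i≢j : i ≢ j) a → a j < a i →
                 total (resize i≢j a (pred (a i)) (suc (a j))) ≡ total a
    total-move {i} {j} i≢j a lt = begin
      total a′                                               ≡⟨ ∑-split i≢j a′ ⟩
      a′ i + a′ j + total (λ y → others i≢j y * a′ y)        ≡⟨ cong₂ _+_ ends middle ⟩
      a i + a j + total (λ y → others i≢j y * a y)           ≡⟨ ∑-split i≢j a ⟨
      total a                                                ∎
      where
      open ≡-Reasoning
      a′ = resize i≢j a (pred (a i)) (suc (a j))
      ends : a′ i + a′ j ≡ a i + a j
      ends = begin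
        a′ i + a′ j                ≡⟨ cong₂ _+_ (resize-i i≢j a _ _) (resize-j i≢j a _ _) ⟩
        pred (a i) + suc (a j)     ≡⟨ +-suc (pred (a i)) (a j) ⟩
        suc (pred (a i)) + a j     ≡⟨ cong (_+ a j) (suc-pred (a i) {{>-nonZero (≤-<-trans z≤n lt)}}) ⟩
        a i + a j                  ∎
      middle : total (λ y → others i≢j y * a′ y) ≡ total (λ y → others i≢j y * a y)
      middle = ∑-cong (allFin k) λ y → others-cong i≢j y (resize-other i≢j a _ _)

    -- Part `j` stays at or below its target even after the gain, so it contributes zero before and
    -- after; part `i` loses one unit of surplus.
    excess-move : ∀ {i j} (i≢j : i ≢ j) a → t i < a i → a j < t j →
                  excess (resize i≢j a (pred (a i)) (suc (a j))) < excess a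
    excess-move {i} {j} i≢j a ti<ai aj<tj = ∑-mono-< shrinks (∈-allFin i) strictly
      where
      shrinks : ∀ y → resize i≢j a (pred (a i)) (suc (a j)) y ∸ t y ≤ a y ∸ t y
      shrinks y with y ≟ i | y ≟ j
      ... | yes refl | _        = ∸-monoˡ-≤ (t y) (pred[n]≤n {a y})
      ... | no _     | yes refl = subst (_≤ a y ∸ t y) (sym (m≤n⇒m∸n≡0 aj<tj)) z≤n
      ... | no _     | no _     = ≤-refl
      strictly : resize i≢j a (pred (a i)) (suc (a j)) i ∸ t i < a i ∸ t i
      strictly rewrite resize-i i≢j a (pred (a i)) (suc (a j)) = pred-∸-< ti<ai

    -- A part j below its target is always smaller than a part i above it, because
    -- a j + 1 ≤ t j ≤ t i + 1 ≤ a i; so F-move applies and the excess drops.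
    balancing : ∀ d a → excess a ≤ d → total a ≡ total t → F a ≤ F t
    balancing d a bound eq with any? (λ i → t i <? a i) | any? (λ j → a j <? t j)
    ... | no ¬over | no ¬under =
      ≤-reflexive (F-cong λ y → ≤-antisym (≮⇒≥ λ lt → ¬over (y , lt)) (≮⇒≥ λ lt → ¬under (y , lt)))
    ... | no ¬over | yes (j , aj<tj) =
      contradiction eq (<⇒≢ (∑-mono-< (λ y → ≮⇒≥ λ lt → ¬over (y , lt)) (∈-allFin j) aj<tj))
    ... | yes (i , ti<ai) | no ¬under =
      contradiction (sym eq) (<⇒≢ (∑-mono-< (λ y → ≮⇒≥ λ lt → ¬under (y , lt)) (∈-allFin i) ti<ai))
    balancing zero a bound eq | yes (i , ti<ai) | yes _ =
      contradiction (≤-trans (m<n⇒0<n∸m ti<ai) (≤-trans (∑-∈-≤ (λ y → a y ∸ t y) (∈-allFin i)) bound)) λ ()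
    balancing (suc d) a bound eq | yes (i , ti<ai) | yes (j , aj<tj) =
      ≤-trans (F-move i≢j a aj<ai)
        (balancing d _ (s≤s⁻¹ (≤-trans (excess-move i≢j a ti<ai aj<tj) bound))
                   (trans (total-move i≢j a aj<ai) eq))
      where
      aj<ai : a j < a i
      aj<ai = ≤-trans aj<tj (≤-trans (t-balanced j i) ti<ai)
      i≢j : i ≢ j
      i≢j refl = <-irrefl refl aj<ai

  balanced-maximal : ∀ a → ∑ (allFin k) a ≡ ∑ (allFin k) t → F a ≤ F t
  balanced-maximal a = balancing _ a ≤-refl

-- Embeddings of sequence graphs into complete multipartite graphs

∣tabulate∣ : ∀ {n} {P : Fin n → Set} (P? : ∀ v → Dec (P v)) →
             ∣ tabulate (λ v → does (P? v)) ∣ ≡ ∑ (allFin n) (λ v → 𝟙 (P? v))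
∣tabulate∣ {zero}  P? = refl
∣tabulate∣ {suc n} P? = trans head (cong (λ xs → 𝟙 (P? zero) + sum xs)
  (trans (map-tabulate id (λ v → 𝟙 (P? (suc v)))) (sym (map-tabulate suc (λ v → 𝟙 (P? v))))))
  where
  head : ∣ tabulate (λ v → does (P? v)) ∣ ≡ 𝟙 (P? zero) + ∑ (allFin n) (λ v → 𝟙 (P? (suc v)))
  head with P? zero
  ... | yes _ = cong suc (∣tabulate∣ (P? ∘ suc))
  ... | no _  = ∣tabulate∣ (P? ∘ suc)

-- Paths laid end to end, with `b` telling where consecutive positions are joined. Indexing `b` by
-- natural numbers lets the rest of a sequence use `b ∘ suc` at every length.
sequenceGraph : (ℕ → Bool) → ∀ m → Graph m
sequenceGraph b m = record
  { Adj    = λ i j → Next i j ⊎ Next j i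
  ; symm   = swap
  ; irrefl = λ v → [ irr , irr ]′
  ; adj?   = λ i j → next? i j ⊎-dec next? j i
  }
  where
  Next : Fin m → Fin m → Set
  Next i j = toℕ j ≡ suc (toℕ i) × T (b (toℕ i))
  next? : ∀ i j → Dec (Next i j)
  next? i j = (toℕ j ℕ.≟ suc (toℕ i)) ×-dec T? (b (toℕ i))
  irr : ∀ {v} → ¬ Next v v
  irr (eq , _) = <⇒≢ (n<1+n _) eq

module _ {n k : ℕ} (c : Fin n → Fin k) where

  open DecMembership {A = Fin n} _≟_ using (_∉?_)

  remaining : List (Fin n) → Fin k → ℕ
  remaining A y = ∑ (allFin n) (λ v → 𝟙 ((v ∉? A) ×-dec (y ≟ c v)))

  remaining-∷ : ∀ {A v} → v ∉ A → remaining (v ∷ A) ≗ decr (c v) (remaining A)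
  remaining-∷ {A} {v} v∉A y = sym (trans (cong (_∸ 𝟙 (y ≟ c v)) split) (m+n∸m≡n (𝟙 (y ≟ c v)) _))
    where
    pointwise : ∀ u → 𝟙 ((u ∉? A) ×-dec (y ≟ c u)) ≡
                      𝟙 (u ≟ v) * 𝟙 (y ≟ c u) + 𝟙 ((u ∉? (v ∷ A)) ×-dec (y ≟ c u))
    pointwise u = begin
      𝟙 ((u ∉? A) ×-dec (y ≟ c u))      ≡⟨ 𝟙-× (u ∉? A) (y ≟ c u) ⟩
      𝟙 (u ∉? A) * 𝟙 (y ≟ c u)          ≡⟨ cong (_* 𝟙 (y ≟ c u)) (membership (u ≟ v)) ⟩
      (𝟙 (u ≟ v) + 𝟙 (u ∉? (v ∷ A))) * 𝟙 (y ≟ c u)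
        ≡⟨ *-distribʳ-+ (𝟙 (y ≟ c u)) (𝟙 (u ≟ v)) _ ⟩
      𝟙 (u ≟ v) * 𝟙 (y ≟ c u) + 𝟙 (u ∉? (v ∷ A)) * 𝟙 (y ≟ c u)
        ≡⟨ cong (𝟙 (u ≟ v) * 𝟙 (y ≟ c u) +_) (𝟙-× (u ∉? (v ∷ A)) (y ≟ c u)) ⟨
      𝟙 (u ≟ v) * 𝟙 (y ≟ c u) + 𝟙 ((u ∉? (v ∷ A)) ×-dec (y ≟ c u)) ∎
      where
      open ≡-Reasoning
      membership : (eq? : Dec (u ≡ v)) → 𝟙 (u ∉? A) ≡ 𝟙 eq? + 𝟙 (u ∉? (v ∷ A))
      membership (yes refl) = trans (𝟙-yes (u ∉? A) v∉A) (cong suc (sym (𝟙-no (u ∉? (u ∷ A)) λ u∉ → u∉ (here refl))))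
      membership (no u≢v) = 𝟙-cong (u ∉? A) (u ∉? (v ∷ A))
                         (λ { u∉ (here u≡v) → u≢v u≡v ; u∉ (there u∈) → u∉ u∈ }) (λ u∉ u∈ → u∉ (there u∈))
    split : remaining A y ≡ 𝟙 (y ≟ c v) + remaining (v ∷ A) y
    split = trans (∑-cong (allFin n) pointwise) (trans (∑-distrib-+ (allFin n) _ _)
      (cong (_+ remaining (v ∷ A) y) (∑-select _≟_ (λ u → 𝟙 (y ≟ c u)) (allFin⁺ n) (∈-allFin v))))

  ∑-remaining : ∀ A (Φ : Fin k → ℕ) →
    ∑ (allFin k) (λ y → remaining A y * Φ y) ≡ ∑ (allFin n) (λ v → 𝟙 (v ∉? A) * Φ (c v))
  ∑-remaining A Φ = begin
    ∑ (allFin k) (λ y → remaining A y * Φ y)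
      ≡⟨ ∑-cong (allFin k) (λ y → *-distribʳ-∑ (allFin n) (Φ y) _) ⟩
    ∑ (allFin k) (λ y → ∑ (allFin n) (λ v → 𝟙 ((v ∉? A) ×-dec (y ≟ c v)) * Φ y))
      ≡⟨ ∑-comm (allFin k) (allFin n) _ ⟩
    ∑ (allFin n) (λ v → ∑ (allFin k) (λ y → 𝟙 ((v ∉? A) ×-dec (y ≟ c v)) * Φ y))
      ≡⟨ ∑-cong (allFin n) inner ⟩
    ∑ (allFin n) (λ v → 𝟙 (v ∉? A) * Φ (c v)) ∎
    where
    open ≡-Reasoning
    inner : ∀ v → ∑ (allFin k) (λ y → 𝟙 ((v ∉? A) ×-dec (y ≟ c v)) * Φ y) ≡ 𝟙 (v ∉? A) * Φ (c v)
    inner v = begin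
      ∑ (allFin k) (λ y → 𝟙 ((v ∉? A) ×-dec (y ≟ c v)) * Φ y)
        ≡⟨ ∑-cong (allFin k) (λ y → trans (cong (_* Φ y) (𝟙-× (v ∉? A) (y ≟ c v)))
                                          (*-assoc (𝟙 (v ∉? A)) (𝟙 (y ≟ c v)) (Φ y))) ⟩
      ∑ (allFin k) (λ y → 𝟙 (v ∉? A) * (𝟙 (y ≟ c v) * Φ y))
        ≡⟨ *-distribˡ-∑ (allFin k) (𝟙 (v ∉? A)) _ ⟨
      𝟙 (v ∉? A) * ∑ (allFin k) (λ y → 𝟙 (y ≟ c v) * Φ y)
        ≡⟨ cong (𝟙 (v ∉? A) *_) (∑-select _≟_ Φ (allFin⁺ k) (∈-allFin (c v))) ⟩
      𝟙 (v ∉? A) * Φ (c v) ∎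

  -- The embedding condition rewritten to be checked from left to right, with the used vertices `A`
  -- and the predecessor's part `x` as state, in step with the recursion of `sequences`.
  Admissible : Bool → (ℕ → Bool) → Fin k → List (Fin n) → ∀ {m} → Vec (Fin n) m → Set
  Admissible l b x A []      = ⊤
  Admissible l b x A (v ∷ w) =
    v ∉ A × ¬ (T l × x ≡ c v) × Admissible (b 0) (b ∘ suc) (c v) (v ∷ A) w

  admissible? : ∀ l b x A {m} (w : Vec (Fin n) m) → Dec (Admissible l b x A w)
  admissible? l b x A []      = yes tt
  admissible? l b x A (v ∷ w) =
    (v ∉? A) ×-dec ¬? (T? l ×-dec (x ≟ c v)) ×-dec admissible? (b 0) (b ∘ suc) (c v) (v ∷ A) w

  count-admissible : ∀ l b x A m →
    ∑ (allVecs (allFin n) m) (λ w → 𝟙 (admissible? l b x A w)) ≡ sequences l b m x (remaining A)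
  count-admissible l b x A zero    = refl
  count-admissible l b x A (suc m) = begin
    ∑ (allVecs (allFin n) (suc m)) (λ w → 𝟙 (admissible? l b x A w))
      ≡⟨ ∑-cartesianProductWith _∷_ (allFin n) (allVecs (allFin n) m) _ ⟩
    ∑ (allFin n) (λ v → ∑ (allVecs (allFin n) m) (λ w → 𝟙 (admissible? l b x A (v ∷ w))))
      ≡⟨ ∑-cong (allFin n) inner ⟩
    ∑ (allFin n) (λ v → 𝟙 (v ∉? A) * Φ (c v))
      ≡⟨ ∑-remaining A Φ ⟨
    ∑ (allFin k) (λ y → remaining A y * Φ y)
      ≡⟨ ∑-cong (allFin k) (λ y → swap-factors (remaining A y) (link l x y) _) ⟩
    sequences l b (suc m) x (remaining A) ∎
    where
    open ≡-Reasoning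
    Φ : Fin k → ℕ
    Φ y = link l x y * sequences (b 0) (b ∘ suc) m y (decr y (remaining A))
    swap-factors : ∀ p q r → p * (q * r) ≡ q * (p * r)
    swap-factors p q r = trans (sym (*-assoc p q r)) (trans (cong (_* r) (*-comm p q)) (*-assoc q p r))
    -- `remaining-∷` holds only for fresh `v`; for a used `v` the indicator annihilates both sides.
    guard : ∀ v → 𝟙 (v ∉? A) * (link l x (c v) * sequences (b 0) (b ∘ suc) m (c v) (remaining (v ∷ A)))
                ≡ 𝟙 (v ∉? A) * Φ (c v)
    guard v with v ∉? A
    ... | yes v∉A = cong (λ z → 1 * (link l x (c v) * z))
                      (sequences-cong (b 0) (b ∘ suc) m (c v) (remaining-∷ v∉A))
    ... | no _    = refl
    inner : ∀ v → ∑ (allVecs (allFin n) m) (λ w → 𝟙 (admissible? l b x A (v ∷ w))) ≡ 𝟙 (v ∉? A) * Φ (c v)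
    inner v = begin
      ∑ W (λ w → 𝟙 (admissible? l b x A (v ∷ w)))
        ≡⟨ ∑-cong W (λ w → trans (𝟙-× (v ∉? A) _) (cong (𝟙 (v ∉? A) *_) (𝟙-× (¬? (T? l ×-dec (x ≟ c v))) _))) ⟩
      ∑ W (λ w → 𝟙 (v ∉? A) * (link l x (c v) * 𝟙 (rest w)))
        ≡⟨ *-distribˡ-∑ W (𝟙 (v ∉? A)) _ ⟨
      𝟙 (v ∉? A) * ∑ W (λ w → link l x (c v) * 𝟙 (rest w))
        ≡⟨ cong (𝟙 (v ∉? A) *_) (*-distribˡ-∑ W (link l x (c v)) _) ⟨
      𝟙 (v ∉? A) * (link l x (c v) * ∑ W (λ w → 𝟙 (rest w)))
        ≡⟨ cong (λ z → 𝟙 (v ∉? A) * (link l x (c v) * z)) (count-admissible (b 0) (b ∘ suc) (c v) (v ∷ A) m) ⟩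
      𝟙 (v ∉? A) * (link l x (c v) * sequences (b 0) (b ∘ suc) m (c v) (remaining (v ∷ A)))
        ≡⟨ guard v ⟩
      𝟙 (v ∉? A) * Φ (c v) ∎
      where
      W = allVecs (allFin n) m
      rest : ∀ w → Dec (Admissible (b 0) (b ∘ suc) (c v) (v ∷ A) w)
      rest = admissible? (b 0) (b ∘ suc) (c v) (v ∷ A)

  Proper : (ℕ → Bool) → ∀ {m} → Vec (Fin n) m → Set
  Proper b w = ∀ i j → toℕ j ≡ suc (toℕ i) → T (b (toℕ i)) → c (lookup w i) ≢ c (lookup w j)

  admissible⇒fresh : ∀ l b x A {m} (w : Vec (Fin n) m) → Admissible l b x A w → ∀ i → lookup w i ∉ A
  admissible⇒fresh l b x A (v ∷ w) (v∉A , _ , _)   zero    = v∉A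
  admissible⇒fresh l b x A (v ∷ w) (_   , _ , adm) (suc i) =
    admissible⇒fresh (b 0) (b ∘ suc) (c v) (v ∷ A) w adm i ∘ there

  admissible⇒injective : ∀ l b x A {m} (w : Vec (Fin n) m) → Admissible l b x A w → Injective _≡_ _≡_ (lookup w)
  admissible⇒injective l b x A (v ∷ w) (_ , _ , adm) {zero}  {zero}  eq = refl
  admissible⇒injective l b x A (v ∷ w) (_ , _ , adm) {zero}  {suc j} eq =
    contradiction (here (sym eq)) (admissible⇒fresh (b 0) (b ∘ suc) (c v) (v ∷ A) w adm j)
  admissible⇒injective l b x A (v ∷ w) (_ , _ , adm) {suc i} {zero}  eq =
    contradiction (here eq) (admissible⇒fresh (b 0) (b ∘ suc) (c v) (v ∷ A) w adm i)
  admissible⇒injective l b x A (v ∷ w) (_ , _ , adm) {suc i} {suc j} eq =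
    cong suc (admissible⇒injective (b 0) (b ∘ suc) (c v) (v ∷ A) w adm eq)

  admissible⇒proper : ∀ l b x A {m} (w : Vec (Fin n) m) → Admissible l b x A w → Proper b w
  admissible⇒proper l b x A (v ∷ u ∷ w) (_ , _ , _ , link , _) zero (suc zero) _ b₀ eq = link (b₀ , eq)
  admissible⇒proper l b x A (v ∷ w) (_ , _ , adm) (suc i) (suc j) next bᵢ =
    admissible⇒proper (b 0) (b ∘ suc) (c v) (v ∷ A) w adm i j (ℕ.suc-injective next) bᵢ

  -- The condition on the first entry ranges over all `i` with `toℕ i ≡ 0` because `w` may be empty.
  admissible : ∀ l b x A {m} (w : Vec (Fin n) m) → (∀ i → lookup w i ∉ A) →
    (∀ i → toℕ i ≡ 0 → ¬ (T l × x ≡ c (lookup w i))) →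
    Injective _≡_ _≡_ (lookup w) → Proper b w → Admissible l b x A w
  admissible l b x A []      fresh start inj proper = tt
  admissible l b x A (v ∷ w) fresh start inj proper =
    fresh zero , start zero refl ,
    admissible (b 0) (b ∘ suc) (c v) (v ∷ A) w
      (λ { i (here eq) → contradiction (inj {suc i} {zero} eq) λ () ; i (there w∈) → fresh (suc i) w∈ })
      (λ i i≡0 (b₀ , eq) → proper zero (suc i) (cong suc i≡0) b₀ eq)
      (λ eq → suc-injective (inj eq))
      (λ i j next → proper (suc i) (suc j) (cong suc next))

  ∣part∣ : ∀ y → ∣ part c y ∣ ≡ remaining [] y
  ∣part∣ y = trans (∣tabulate∣ (λ v → c v ≟ y)) (∑-cong (allFin n) λ v →
    𝟙-cong (c v ≟ y) ((v ∉? []) ×-dec (y ≟ c v)) (λ eq → (λ ()) , sym eq) (λ (_ , eq) → sym eq))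

  ∑-remaining-[] : ∑ (allFin k) (remaining []) ≡ ∑ (allFin n) (λ _ → 1)
  ∑-remaining-[] = trans (∑-cong (allFin k) λ y → sym (*-identityʳ _))
    (trans (∑-remaining [] (λ _ → 1)) (∑-cong (allFin n) λ v → cong (_* 1) (𝟙-yes (v ∉? []) λ ())))

-- Part sizes of a balanced partition

⌊/⌋≤⌈/⌉ : ∀ n k .{{_ : NonZero k}} → ⌊ n / k ⌋ ≤ ⌈ n / k ⌉
⌊/⌋≤⌈/⌉ n k = /-monoˡ-≤ k (m≤m+n n (pred k))

⌈/⌉≤1+⌊/⌋ : ∀ n k .{{_ : NonZero k}} → ⌈ n / k ⌉ ≤ suc ⌊ n / k ⌋
⌈/⌉≤1+⌊/⌋ n k = begin
  (n + pred k) / k   ≤⟨ /-monoˡ-≤ k (+-monoʳ-≤ n (pred[n]≤n {k})) ⟩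
  (n + k) / k        ≡⟨ +-distrib-/-∣ʳ n (∣-refl {k}) ⟩
  n / k + k / k      ≡⟨ cong (n / k +_) (n/n≡1 k) ⟩
  n / k + 1          ≡⟨ +-comm (n / k) 1 ⟩
  suc (n / k)        ∎
  where open ≤-Reasoning

module _ {n k : ℕ} .{{_ : NonZero k}} (c : Fin n → Fin k) (balanced : IsBalanced c) where

  balanced-parts : ∀ i j → remaining c [] i ≤ suc (remaining c [] j)
  balanced-parts i j = subst₂ (λ p q → p ≤ suc q) (∣part∣ c i) (∣part∣ c j)
    (≤-trans (≤⌈⌉ (balanced i)) (≤-trans (⌈/⌉≤1+⌊/⌋ n k) (s≤s (⌊⌋≤ (balanced j)))))
    where
    ≤⌈⌉ : ∀ {p} → p ≡ ⌊ n / k ⌋ ⊎ p ≡ ⌈ n / k ⌉ → p ≤ ⌈ n / k ⌉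
    ≤⌈⌉ (inj₁ refl) = ⌊/⌋≤⌈/⌉ n k
    ≤⌈⌉ (inj₂ refl) = ≤-refl
    ⌊⌋≤ : ∀ {p} → p ≡ ⌊ n / k ⌋ ⊎ p ≡ ⌈ n / k ⌉ → ⌊ n / k ⌋ ≤ p
    ⌊⌋≤ (inj₁ refl) = ≤-refl
    ⌊⌋≤ (inj₂ refl) = ⌊/⌋≤⌈/⌉ n k

  sequences-maximal : ∀ (c′ : Fin n → Fin k) b m x →
    sequences false b m x (remaining c′ []) ≤ sequences false b m x (remaining c [])
  sequences-maximal c′ b m x = balanced-maximal (sequences false b m x) (sequences-cong false b m x)
    (λ i≢j → sequences-move i≢j b m x) (remaining c []) balanced-parts (remaining c′ [])
    (trans (∑-remaining-[] c′) (sym (∑-remaining-[] c)))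

-- Copies and embeddings

open Equivalence using (to; from)
open IsIsomorphismOnto
open IsSubgraph

private
  variable
    h n m : ℕ

∈-tabulate⁺ : {P : Fin n → Set} (P? : ∀ v → Dec (P v)) → ∀ {v} → P v → v ∈ˢ tabulate (λ u → does (P? u))
∈-tabulate⁺ P? {v} p = Vec.lookup⇒[]= v _ (trans (Vec.lookup∘tabulate _ v) (dec-true (P? v) p))

∈-tabulate⁻ : {P : Fin n → Set} (P? : ∀ v → Dec (P v)) → ∀ {v} → v ∈ˢ tabulate (λ u → does (P? u)) → P v
∈-tabulate⁻ P? {v} v∈ with P? v | trans (sym (Vec.lookup∘tabulate (λ u → does (P? u)) v)) (Vec.[]=⇒lookup v∈)
... | yes p | _  = p
... | no _  | ()

Code : ℕ → Set
Code n = Subset n × Vec (Subset n) n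

codes : ∀ n → List (Code n)
codes n = cartesianProduct (allSubsets n) (allVecs (allSubsets n) n)

_≟ᶜ_ : DecidableEquality (Code n)
_≟ᶜ_ = Product.≡-dec (Vec.≡-dec Bool._≟_) (Vec.≡-dec (Vec.≡-dec Bool._≟_))

∈-codes : (X : Code n) → X ∈ codes n
∈-codes (V , E) = ∈-cartesianProduct⁺ (subset V) (allVecs-∈ subset E)
  where
  subset : ∀ {m} (p : Subset m) → p ∈ allSubsets m
  subset = allVecs-∈ λ { true → here refl ; false → there (here refl) }

codes-unique : ∀ n → Unique (codes n)
codes-unique n = cartesianProduct⁺ (subsets n) (allVecs-unique (subsets n) n)
  where
  subsets : ∀ m → Unique (allSubsets m)
  subsets = allVecs-unique (((λ ()) ∷ []) ∷ [] ∷ [])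

words : ∀ n h → List (Vec (Fin n) h)
words n = allVecs (allFin n)

∈-words : (w : Vec (Fin n) h) → w ∈ words n h
∈-words = allVecs-∈ ∈-allFin

words-unique : ∀ n h → Unique (words n h)
words-unique n = allVecs-unique (allFin⁺ n)

module _ (S : Graph h) where

  Traces : Vec (Fin n) h → Code n → Set
  Traces w (V , E) = IsIsomorphismOnto S (_∈ˢ V) (EdgeOf E) (lookup w)

  traces? : ∀ (w : Vec (Fin n) h) X → Dec (Traces w X)
  traces? w (V , E) = isIsomorphismOnto? S (_∈ˢ? V) (edgeOf? E) (lookup w)

  -- For `X` isomorphic to `S` this is the order of the automorphism group of `S`.
  tracings : Code n → ℕ
  tracings {n} X = ∑ (words n h) (λ w → 𝟙 (traces? w X))

  Embeds : Graph n → Vec (Fin n) h → Set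
  Embeds G w = Injective _≡_ _≡_ (lookup w) × (∀ i j → Adj S i j → Adj G (lookup w i) (lookup w j))

  embeds? : (G : Graph n) → ∀ w → Dec (Embeds G w)
  embeds? G w = map′ (λ (inj , adj) → (λ {i} {j} → inj i j) , adj) (λ (inj , adj) → (λ i j → inj {i} {j}) , adj)
    (all? (λ i → all? λ j → (lookup w i ≟ lookup w j) →-dec (i ≟ j))
     ×-dec all? (λ i → all? λ j → adj? S i j →-dec adj? G (lookup w i) (lookup w j)))

  module _ (w : Vec (Fin n) h) where

    private
      vertex? : ∀ v → Dec (∃ λ i → lookup w i ≡ v)
      vertex? v = any? λ i → lookup w i ≟ v

      Edge : Fin n → Fin n → Set
      Edge u v = ∃ λ i → ∃ λ j → lookup w i ≡ u × lookup w j ≡ v × Adj S i j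

      edge? : ∀ u v → Dec (Edge u v)
      edge? u v = any? λ i → any? λ j → (lookup w i ≟ u) ×-dec (lookup w j ≟ v) ×-dec adj? S i j

      vertices : Subset n
      vertices = tabulate λ v → does (vertex? v)

      row : Fin n → Subset n
      row u = tabulate λ v → does (edge? u v)

      ∈-row : ∀ {u v} → v ∈ˢ lookup (tabulate row) u ⇔ v ∈ˢ row u
      ∈-row {u} {v} = mk⇔ (subst (v ∈ˢ_) (Vec.lookup∘tabulate row u)) (subst (v ∈ˢ_) (sym (Vec.lookup∘tabulate row u)))

    trace : Code n
    trace = vertices , tabulate row

    -- The isomorphism determines the edges between image vertices, and `endpoints` excludes all
    -- others; hence `w` determines the code.
    traces⇒≡trace : ∀ {G : Graph n} {X} → IsSubgraph G (proj₁ X) (proj₂ X) → Traces w X → X ≡ trace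
    traces⇒≡trace {X = V , E} sub iso = cong₂ _,_
      (⊆-antisym (λ {v} v∈ → ∈-tabulate⁺ vertex? (to (image iso v) v∈))
                 (λ {v} v∈ → from (image iso v) (∈-tabulate⁻ vertex? v∈)))
      (trans (sym (Vec.tabulate∘lookup E)) (Vec.tabulate-cong λ u →
        ⊆-antisym (λ v∈ → ∈-tabulate⁺ (edge? u) (forth v∈))
                  (λ v∈ → back (∈-tabulate⁻ (edge? u) v∈))))
      where
      forth : ∀ {u v} → EdgeOf E u v → Edge u v
      forth {u} {v} e with endpoints sub u v e
      ... | u∈ , v∈ with to (image iso u) u∈ | to (image iso v) v∈
      ...   | i , refl | j , refl = i , j , refl , refl , from (adjacency iso i j) e
      back : ∀ {u v} → Edge u v → EdgeOf E u v
      back (i , j , refl , refl , adj) = to (adjacency iso i j) adj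

    module _ (G : Graph n) where

      trace-traces : Embeds G w → Traces w trace
      trace-traces (inj , _) = record
        { injective = inj
        ; image     = λ v → mk⇔ (∈-tabulate⁻ vertex?) (∈-tabulate⁺ vertex?)
        ; adjacency = λ i j → mk⇔
            (λ adj → from ∈-row (∈-tabulate⁺ (edge? _) (i , j , refl , refl , adj)))
            (λ e → let (i′ , j′ , eqᵢ , eqⱼ , adj) = ∈-tabulate⁻ (edge? _) (to ∈-row e)
                   in subst₂ (Adj S) (inj eqᵢ) (inj eqⱼ) adj)
        }

      trace-subgraph : Embeds G w → IsSubgraph G (proj₁ trace) (proj₂ trace)
      trace-subgraph (_ , hom) = record
        { symmetric = λ u v e → let (i , j , eqᵢ , eqⱼ , adj) = edge e in
            from ∈-row (∈-tabulate⁺ (edge? v) (j , i , eqⱼ , eqᵢ , symm S adj))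
        ; endpoints = λ u v e → let (i , j , eqᵢ , eqⱼ , adj) = edge e in
            ∈-tabulate⁺ vertex? (i , eqᵢ) , ∈-tabulate⁺ vertex? (j , eqⱼ)
        ; edges     = λ u v e → let (i , j , eqᵢ , eqⱼ , adj) = edge e in
            subst₂ (Adj G) eqᵢ eqⱼ (hom i j adj)
        }
        where
        edge : ∀ {u v} → v ∈ˢ lookup (tabulate row) u → Edge u v
        edge e = ∈-tabulate⁻ (edge? _) (to ∈-row e)

  -- Each embedding traces exactly one copy, its image, and every tuple tracing a copy is an
  -- embedding.
  traces-copy : ∀ (G : Graph n) w X → 𝟙 (isCopy? S G X) * 𝟙 (traces? w X) ≡ 𝟙 (X ≟ᶜ trace w) * 𝟙 (embeds? G w)
  traces-copy G w X = begin
    𝟙 (isCopy? S G X) * 𝟙 (traces? w X)        ≡⟨ 𝟙-× (isCopy? S G X) (traces? w X) ⟨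
    𝟙 (isCopy? S G X ×-dec traces? w X)        ≡⟨ 𝟙-cong _ ((X ≟ᶜ trace w) ×-dec embeds? G w) forth back ⟩
    𝟙 ((X ≟ᶜ trace w) ×-dec embeds? G w)       ≡⟨ 𝟙-× (X ≟ᶜ trace w) (embeds? G w) ⟩
    𝟙 (X ≟ᶜ trace w) * 𝟙 (embeds? G w)         ∎
    where
    open ≡-Reasoning
    forth : IsCopy S G X × Traces w X → X ≡ trace w × Embeds G w
    forth ((sub , _) , iso) = traces⇒≡trace w {G} sub iso ,
      injective iso , λ i j adj → edges sub _ _ (to (adjacency iso i j) adj)
    back : X ≡ trace w × Embeds G w → IsCopy S G X × Traces w X
    back (refl , emb) = (trace-subgraph w G emb , lookup w , trace-traces w G emb) , trace-traces w G emb

  double-count : (G : Graph n) →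
    ∑ (codes n) (λ X → 𝟙 (isCopy? S G X) * tracings X) ≡ ∑ (words n h) (λ w → 𝟙 (embeds? G w))
  double-count {n} G = begin
    ∑ (codes n) (λ X → 𝟙 (isCopy? S G X) * tracings X)
      ≡⟨ ∑-cong (codes n) (λ X → *-distribˡ-∑ (words n h) (𝟙 (isCopy? S G X)) _) ⟩
    ∑ (codes n) (λ X → ∑ (words n h) (λ w → 𝟙 (isCopy? S G X) * 𝟙 (traces? w X)))
      ≡⟨ ∑-comm (codes n) (words n h) _ ⟩
    ∑ (words n h) (λ w → ∑ (codes n) (λ X → 𝟙 (isCopy? S G X) * 𝟙 (traces? w X)))
      ≡⟨ ∑-cong (words n h) (λ w → trans (∑-cong (codes n) (traces-copy G w))
           (∑-select _≟ᶜ_ (λ _ → 𝟙 (embeds? G w)) (codes-unique n) (∈-codes (trace w)))) ⟩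
    ∑ (words n h) (λ w → 𝟙 (embeds? G w)) ∎
    where open ≡-Reasoning

  IsomorphicToCode : Code n → Set
  IsomorphicToCode (V , E) = IsomorphicTo S (_∈ˢ V) (EdgeOf E)

  module Transport (X X′ : Code n) (φ : IsomorphicToCode X) (φ′ : IsomorphicToCode X′) where

    private
      f = proj₁ φ
      isoᶠ = proj₂ φ
      g = proj₁ φ′
      isoᵍ = proj₂ φ′
      E = proj₂ X
      E′ = proj₂ X′

    transport : Fin n → Fin n
    transport v with any? (λ i → f i ≟ v)
    ... | yes (i , _) = g i
    -- Default outside the image of `f`; tuples tracing `X` never take such values.
    ... | no _        = v

    transport-f : ∀ i → transport (f i) ≡ g i
    transport-f i with any? (λ i′ → f i′ ≟ f i)
    ... | yes (i′ , eq) = cong g (injective isoᶠ eq)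
    ... | no ¬∃         = contradiction (i , refl) ¬∃

    transport-traces : ∀ w → Traces w X → Traces (Vec.map transport w) X′
    transport-traces w iso = record
      { injective = λ {i} {j} eq → injective iso (trans (sym (f∘τ i)) (trans
          (cong f (injective isoᵍ (trans (sym (moved i)) (trans eq (moved j))))) (f∘τ j)))
      ; image = λ v → mk⇔
          (λ v∈ → let (i′ , gi′≡v) = to (image isoᵍ v) v∈
                      (i , wi≡fi′) = to (image iso (f i′)) (from (image isoᶠ (f i′)) (i′ , refl))
                  in i , trans (Vec.lookup-map i transport w)
                           (trans (cong transport wi≡fi′) (trans (transport-f i′) gi′≡v)))
          (λ (i , eq) → from (image isoᵍ v) (τ i , trans (sym (moved i)) eq))
      ; adjacency = λ i j → mk⇔
          (λ adj → subst₂ (EdgeOf E′) (sym (moved i)) (sym (moved j)) (to (adjacency isoᵍ (τ i) (τ j))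
            (from (adjacency isoᶠ (τ i) (τ j)) (subst₂ (EdgeOf E) (sym (f∘τ i)) (sym (f∘τ j))
              (to (adjacency iso i j) adj)))))
          (λ e → from (adjacency iso i j) (subst₂ (EdgeOf E) (f∘τ i) (f∘τ j)
            (to (adjacency isoᶠ (τ i) (τ j)) (from (adjacency isoᵍ (τ i) (τ j))
              (subst₂ (EdgeOf E′) (moved i) (moved j) e)))))
      }
      where
      -- Writing `w` as `f ∘ τ` turns the transported tuple into `g ∘ τ`.
      preimage : ∀ i → ∃ λ i′ → f i′ ≡ lookup w i
      preimage i = to (image isoᶠ _) (from (image iso _) (i , refl))
      τ : Fin h → Fin h
      τ i = proj₁ (preimage i)
      f∘τ : ∀ i → f (τ i) ≡ lookup w i
      f∘τ i = proj₂ (preimage i)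
      moved : ∀ i → lookup (Vec.map transport w) i ≡ g (τ i)
      moved i = trans (Vec.lookup-map i transport w)
        (trans (cong transport (sym (f∘τ i))) (transport-f (τ i)))

  transport-inverse : ∀ (X X′ : Code n) φ φ′ w → Traces w X →
    Vec.map (Transport.transport X′ X φ′ φ) (Vec.map (Transport.transport X X′ φ φ′) w) ≡ w
  transport-inverse X X′ φ@(f , isoᶠ) φ′ w iso = begin
    Vec.map θ′ (Vec.map θ w)                      ≡⟨ Vec.tabulate∘lookup _ ⟨
    tabulate (lookup (Vec.map θ′ (Vec.map θ w)))  ≡⟨ Vec.tabulate-cong pointwise ⟩
    tabulate (lookup w)                           ≡⟨ Vec.tabulate∘lookup w ⟩
    w                                             ∎
    where
    open ≡-Reasoning
    θ = Transport.transport X X′ φ φ′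
    θ′ = Transport.transport X′ X φ′ φ
    pointwise : ∀ i → lookup (Vec.map θ′ (Vec.map θ w)) i ≡ lookup w i
    pointwise i with to (image isoᶠ _) (from (image iso _) (i , refl))
    ... | i′ , eq = begin
      lookup (Vec.map θ′ (Vec.map θ w)) i   ≡⟨ Vec.lookup-map i θ′ (Vec.map θ w) ⟩
      θ′ (lookup (Vec.map θ w) i)           ≡⟨ cong θ′ (Vec.lookup-map i θ w) ⟩
      θ′ (θ (lookup w i))                   ≡⟨ cong (θ′ ∘ θ) eq ⟨
      θ′ (θ (f i′))                         ≡⟨ cong θ′ (Transport.transport-f X X′ φ φ′ i′) ⟩
      θ′ (proj₁ φ′ i′)                      ≡⟨ Transport.transport-f X′ X φ′ φ i′ ⟩
      f i′                                  ≡⟨ eq ⟩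
      lookup w i                            ∎

  tracings-constant : ∀ (X X′ : Code n) → IsomorphicToCode X → IsomorphicToCode X′ → tracings X ≡ tracings X′
  tracings-constant {n} X X′ φ φ′ =
    ∑-bijection (Vec.≡-dec _≟_) (λ w → traces? w X) (λ w → traces? w X′)
      (Vec.map (Transport.transport X X′ φ φ′)) (Vec.map (Transport.transport X′ X φ′ φ))
      (λ {w} t → Transport.transport-traces X X′ φ φ′ w t , transport-inverse X X′ φ φ′ w t)
      (λ {w} t → Transport.transport-traces X′ X φ′ φ w t , transport-inverse X′ X φ′ φ w t)
      (words-unique n h) ∈-words

  tracings-positive : ∀ (X : Code n) → IsomorphicToCode X → 1 ≤ tracings X
  tracings-positive {n} X@(V , E) (f , iso) =
    subst (_≤ tracings X) (𝟙-yes (traces? (tabulate f) X) traced)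
      (∑-∈-≤ (λ w → 𝟙 (traces? w X)) (∈-words (tabulate f)))
    where
    f≗ : ∀ i → lookup (tabulate f) i ≡ f i
    f≗ = Vec.lookup∘tabulate f
    traced : Traces (tabulate f) X
    traced = record
      { injective = λ {i} {j} eq → injective iso (trans (sym (f≗ i)) (trans eq (f≗ j)))
      ; image     = λ v → mk⇔
          (λ v∈ → let (i , eq) = to (image iso v) v∈ in i , trans (f≗ i) eq)
          (λ (i , eq) → from (image iso v) (i , trans (sym (f≗ i)) eq))
      ; adjacency = λ i j → mk⇔
          (λ adj → subst₂ (EdgeOf E) (sym (f≗ i)) (sym (f≗ j)) (to (adjacency iso i j) adj))
          (λ e → from (adjacency iso i j) (subst₂ (EdgeOf E) (f≗ i) (f≗ j) e))
      }

  𝓝-as-∑ : (G : Graph n) → 𝓝 S G ≡ ∑ (codes n) (λ X → 𝟙 (isCopy? S G X))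
  𝓝-as-∑ {n} G = length-filter (isCopy? S G) (codes n)

  𝓝*tracings : (G : Graph n) (X : Code n) → IsomorphicToCode X →
    𝓝 S G * tracings X ≡ ∑ (words n h) (λ w → 𝟙 (embeds? G w))
  𝓝*tracings {n} G X iso = begin
    𝓝 S G * tracings X
      ≡⟨ cong (_* tracings X) (𝓝-as-∑ G) ⟩
    ∑ (codes n) (λ Y → 𝟙 (isCopy? S G Y)) * tracings X
      ≡⟨ *-distribʳ-∑ (codes n) (tracings X) _ ⟩
    ∑ (codes n) (λ Y → 𝟙 (isCopy? S G Y) * tracings X)
      ≡⟨ ∑-cong (codes n) (λ Y → same Y (isCopy? S G Y)) ⟩
    ∑ (codes n) (λ Y → 𝟙 (isCopy? S G Y) * tracings Y)
      ≡⟨ double-count G ⟩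
    ∑ (words n h) (λ w → 𝟙 (embeds? G w)) ∎
    where
    open ≡-Reasoning
    same : ∀ Y (copy? : Dec (IsCopy S G Y)) → 𝟙 copy? * tracings X ≡ 𝟙 copy? * tracings Y
    same Y (yes (_ , iso′)) = cong (1 *_) (tracings-constant X Y iso iso′)
    same Y (no _)           = refl

  𝓝-none : (G : Graph n) → ¬ Any.Any (IsCopy S G) (codes n) → 𝓝 S G ≡ 0
  𝓝-none {n} G none = cong length (filter-none (isCopy? S G) (¬Any⇒All¬ (codes n) none))

  -- The common multiplicity is cancelled, and a copy in `G` supplies the code that defines it. No
  -- such code need exist, for instance if `S` has more than `n` vertices; without a copy in `G` the
  -- left side is zero.
  𝓝-mono : (G G′ : Graph n) →
    ∑ (words n h) (λ w → 𝟙 (embeds? G w)) ≤ ∑ (words n h) (λ w → 𝟙 (embeds? G′ w)) → 𝓝 S G ≤ 𝓝 S G′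
  𝓝-mono {n} G G′ le = split (Any.any? (isCopy? S G) (codes n))
    where
    cancel : ∃ (IsCopy S G) → 𝓝 S G ≤ 𝓝 S G′
    cancel (X , _ , iso) = *-cancelʳ-≤ (𝓝 S G) (𝓝 S G′) (tracings X)
      {{>-nonZero (tracings-positive X iso)}}
      (subst₂ _≤_ (sym (𝓝*tracings G X iso)) (sym (𝓝*tracings G′ X iso)) le)
    split : Dec (Any.Any (IsCopy S G) (codes n)) → 𝓝 S G ≤ 𝓝 S G′
    split (yes some) = cancel (Any.satisfied some)
    split (no none)  = ≤-trans (≤-reflexive (𝓝-none G none)) z≤n

module _ (c : Fin n → Fin m) (G : Graph n) (partite : IsCompletePartiteWith c G) where

  embeddings≡sequences : ∀ b h x →
    ∑ (words n h) (λ w → 𝟙 (embeds? (sequenceGraph b h) G w)) ≡ sequences false b h x (remaining c [])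
  embeddings≡sequences b h x = trans
    (∑-cong (words n h) λ w → 𝟙-cong (embeds? (sequenceGraph b h) G w) (admissible? c false b x [] w)
      (λ (inj , hom) → admissible c false b x [] w (λ _ ()) (λ _ _ ()) inj
        λ i j next linked → to (partite _ _) (hom i j (inj₁ (next , linked))))
      (λ adm → admissible⇒injective c false b x [] w adm , λ i j adj → from (partite _ _) (proper adm i j adj)))
    (count-admissible c false b x [] h)
    where
    proper : ∀ {w} → Admissible c false b x [] w → ∀ i j → Adj (sequenceGraph b h) i j →
             c (lookup w i) ≢ c (lookup w j)
    proper {w} adm i j (inj₁ (next , linked)) = admissible⇒proper c false b x [] w adm i j next linked
    proper {w} adm i j (inj₂ (next , linked)) = admissible⇒proper c false b x [] w adm j i next linked ∘ sym

-- Arranging a linear forest in a sequence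

-- An isomorphism from a sequence graph onto part of `H`, with `m` below `h` while it is being
-- built. The field `closed` makes the placed vertices a union of components, so that a further
-- component can be appended without new adjacencies.
record Arrangement (H : Graph h) (m : ℕ) : Set where
  field
    place     : Fin m → Fin h
    links     : ℕ → Bool
    injective : Injective _≡_ _≡_ place
    adjacency : ∀ i j → Adj (sequenceGraph links m) i j ⇔ Adj H (place i) (place j)
    closed    : ∀ i v → Adj H (place i) v → ∃ λ j → place j ≡ v

  Placed : Fin h → Set
  Placed v = ∃ λ i → place i ≡ v

↑-elim : ∀ m {n} {P : Fin (m + n) → Set} → (∀ i → P (i ↑ˡ n)) → (∀ j → P (m ↑ʳ j)) → ∀ x → P x
↑-elim m {n} {P} left right x = subst P (join-splitAt m n x) (helper (splitAt m x))
  where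
  helper : (s : Fin m ⊎ Fin n) → P (join m n s)
  helper (inj₁ i) = left i
  helper (inj₂ j) = right j

module Append {H : Graph h} (A : Arrangement H m) (v : Fin h) (new : ¬ Arrangement.Placed A v)
              {l : ℕ} (f : Fin l → Fin h) (iso : IsIsomorphismOnto (pathGraph l) (Connected H v) (Adj H) f) where

  open Arrangement A renaming (injective to place-injective; adjacency to place-adjacency)

  spread : ∀ {u w} → Placed u → Star (Adj H) u w → Placed w
  spread p          ε          = p
  spread (i , refl) (adj ◅ ad) = spread (closed i _ adj) ad

  connected : ∀ a → Connected H v (f a)
  connected a = from (image iso (f a)) (a , refl)

  -- A common vertex would be joined to `v` inside its component, and `spread` would then place `v`.
  disjoint : ∀ i a → place i ≢ f a
  disjoint i a eq = new (spread (i , eq) (reverse (symm H) (connected a)))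

  place′ : Fin (m + l) → Fin h
  place′ x = [ place , f ]′ (splitAt m x)

  place′-ˡ : ∀ i → place′ (i ↑ˡ l) ≡ place i
  place′-ˡ i = cong [ place , f ]′ (splitAt-↑ˡ m i l)

  place′-ʳ : ∀ a → place′ (m ↑ʳ a) ≡ f a
  place′-ʳ a = cong [ place , f ]′ (splitAt-↑ʳ m l a)

  -- The link between the old sequence and the new path must be cut, whatever `links` says there. At
  -- the last old position, x = m - 1, both tests fail and the value is `false`; from `m` on
  -- everything is linked.
  links′ : ℕ → Bool
  links′ x = if does (suc x <? m) then links x else does (m ≤? x)

  links′-inside : ∀ {x} → suc x < m → links′ x ≡ links x
  links′-inside {x} lt rewrite dec-true (suc x <? m) lt = refl

  links′-boundary : ∀ {x} → suc x ≡ m → links′ x ≡ false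
  links′-boundary {x} refl rewrite dec-false (suc x <? suc x) (<-irrefl refl) = refl

  links′-outside : ∀ {x} → m ≤ x → links′ x ≡ true
  links′-outside {x} le rewrite dec-false (suc x <? m) (≤⇒≯ (m≤n⇒m≤1+n le)) = dec-true (m ≤? x) le

  S′ : Graph (m + l)
  S′ = sequenceGraph links′ (m + l)

  Next : ℕ → ℕ → Set
  Next p q = q ≡ suc p × T (links′ p)

  ¬next-across : ∀ (i : Fin m) a → ¬ Next (toℕ i) (m + a)
  ¬next-across i a (eq , linked) = subst T (links′-boundary
    (≤-antisym (toℕ<n i) (subst (m ≤_) eq (m≤m+n m a)))) linked

  ¬next-back : ∀ (i : Fin m) a → ¬ Next (m + a) (toℕ i)
  ¬next-back i a (eq , _) = <⇒≱ (toℕ<n i) (subst (m ≤_) (sym eq) (m≤n⇒m≤1+n (m≤m+n m a)))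

  ¬adj-across : ∀ i a → ¬ Adj H (place i) (f a)
  ¬adj-across i a adj with closed i (f a) adj
  ... | j , eq = disjoint j a eq

  next-inside : ∀ (i j : Fin m) → Next (toℕ i) (toℕ j) ⇔ (toℕ j ≡ suc (toℕ i) × T (links (toℕ i)))
  next-inside i j = mk⇔ (λ (eq , t) → eq , subst T (same eq) t) (λ (eq , t) → eq , subst T (sym (same eq)) t)
    where
    same : toℕ j ≡ suc (toℕ i) → links′ (toℕ i) ≡ links (toℕ i)
    same eq = links′-inside (subst (_< m) eq (toℕ<n j))

  next-outside : ∀ p q → Next (m + p) (m + q) ⇔ q ≡ suc p
  next-outside p q = mk⇔
    (λ (eq , _) → +-cancelˡ-≡ m q (suc p) (trans eq (sym (+-suc m p))))
    (λ eq → trans (cong (m +_) eq) (+-suc m p) , subst T (sym (links′-outside (m≤m+n m p))) _)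

  Steps : ℕ → ℕ → Set
  Steps p q = Next p q ⊎ Next q p

  steps : ∀ {p q} x y → toℕ x ≡ p → toℕ y ≡ q → Steps p q ⇔ Adj S′ x y
  steps x y refl refl = mk⇔ id id

  infixr 5 _⨾_
  _⨾_ : {P Q R : Set} → P ⇔ Q → Q ⇔ R → P ⇔ R
  e ⨾ e′ = mk⇔ (to e′ ∘ to e) (from e ∘ from e′)

  inverse : {P Q : Set} → P ⇔ Q → Q ⇔ P
  inverse e = mk⇔ (from e) (to e)

  _⊎⇔_ : {P Q P′ Q′ : Set} → P ⇔ P′ → Q ⇔ Q′ → (P ⊎ Q) ⇔ (P′ ⊎ Q′)
  e ⊎⇔ e′ = mk⇔ (Sum.map (to e) (to e′)) (Sum.map (from e) (from e′))

  adj-cong : ∀ {u u′ w w′} → u ≡ u′ → w ≡ w′ → Adj H u′ w′ ⇔ Adj H u w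
  adj-cong refl refl = mk⇔ id id

  absurd⇔ : {P Q : Set} → ¬ P → ¬ Q → P ⇔ Q
  absurd⇔ ¬p ¬q = mk⇔ (λ p → contradiction p ¬p) (λ q → contradiction q ¬q)

  -- The mixed blocks are empty on both sides: in `S′` by the cut link, in `H` because the placed
  -- vertices are closed under adjacency and disjoint from the new component.
  adjacency′ : ∀ x y → Adj S′ x y ⇔ Adj H (place′ x) (place′ y)
  adjacency′ = ↑-elim m
    (λ i → ↑-elim m
      (λ j → inverse (steps _ _ (toℕ-↑ˡ i l) (toℕ-↑ˡ j l)) ⨾ (next-inside i j ⊎⇔ next-inside j i)
             ⨾ place-adjacency i j ⨾ adj-cong (place′-ˡ i) (place′-ˡ j))
      (λ b → inverse (steps _ _ (toℕ-↑ˡ i l) (toℕ-↑ʳ m b))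
             ⨾ absurd⇔ [ ¬next-across i _ , ¬next-back i _ ]′ (¬adj-across i b)
             ⨾ adj-cong (place′-ˡ i) (place′-ʳ b)))
    (λ a → ↑-elim m
      (λ j → inverse (steps _ _ (toℕ-↑ʳ m a) (toℕ-↑ˡ j l))
             ⨾ absurd⇔ [ ¬next-back j _ , ¬next-across j _ ]′ (¬adj-across j a ∘ symm H)
             ⨾ adj-cong (place′-ʳ a) (place′-ˡ j))
      (λ b → inverse (steps _ _ (toℕ-↑ʳ m a) (toℕ-↑ʳ m b)) ⨾ (next-outside _ _ ⊎⇔ next-outside _ _)
             ⨾ IsIsomorphismOnto.adjacency iso a b ⨾ adj-cong (place′-ʳ a) (place′-ʳ b)))

  injective′ : ∀ x y → place′ x ≡ place′ y → x ≡ y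
  injective′ = ↑-elim m
    (λ i → ↑-elim m
      (λ j eq → cong (_↑ˡ l) (place-injective (trans (sym (place′-ˡ i)) (trans eq (place′-ˡ j)))))
      (λ b eq → contradiction (trans (sym (place′-ˡ i)) (trans eq (place′-ʳ b))) (disjoint i b)))
    (λ a → ↑-elim m
      (λ j eq → contradiction (sym (trans (sym (place′-ʳ a)) (trans eq (place′-ˡ j)))) (disjoint j a))
      (λ b eq → cong (m ↑ʳ_) (IsIsomorphismOnto.injective iso (trans (sym (place′-ʳ a)) (trans eq (place′-ʳ b))))))

  Placed′ : Fin h → Set
  Placed′ u = ∃ λ x → place′ x ≡ u

  keep : ∀ {u} → Placed u → Placed′ u
  keep (i , eq) = i ↑ˡ l , trans (place′-ˡ i) eq

  reach : ∀ {u} → Connected H v u → Placed′ u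
  reach {u} path with to (image iso u) path
  ... | a , eq = m ↑ʳ a , trans (place′-ʳ a) eq

  appended : Arrangement H (m + l)
  appended = record
    { place     = place′
    ; links     = links′
    ; injective = λ {x} {y} → injective′ x y
    ; adjacency = adjacency′
    ; closed    = ↑-elim m
        (λ i u adj → keep (closed i u (subst (λ z → Adj H z u) (place′-ˡ i) adj)))
        (λ a u adj → reach (connected a ◅◅ (subst (λ z → Adj H z u) (place′-ʳ a) adj ◅ ε)))
    }

open Arrangement using (Placed)

-- A vertex of the list may already be placed within the component of another one; otherwise its
-- whole component is appended. The length is therefore part of the result.
arrange : (H : Graph h) → LinearForest H → (vs : List (Fin h)) →
          ∃ λ m → ∃ λ (A : Arrangement H m) → ∀ {v} → v ∈ vs → Placed A v
arrange H forest [] = 0 , record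
  { place = λ () ; links = λ _ → false ; injective = λ { {()} } ; adjacency = λ () ; closed = λ () } , λ ()
arrange H forest (v ∷ vs) with arrange H forest vs
... | m , A , covers with any? (λ i → Arrangement.place A i ≟ v)
...   | yes placed = m , A , λ { (here refl) → placed ; (there u∈) → covers u∈ }
...   | no ¬placed with forest v
...     | l , f , iso = m + l , appended , λ { (here refl) → reach ε ; (there u∈) → keep (covers u∈) }
  where open Append A v ¬placed f iso

-- Both `place` and the choice of a position for every vertex are injective, which forces `m` to
-- equal `h`.
full-arrangement : (H : Graph h) → LinearForest H →
                   ∃ λ (A : Arrangement H h) → ∀ v → Placed A v
full-arrangement {h} H forest with arrange H forest (allFin h)
... | m , A , covers with ≤-antisym (injective⇒≤ (Arrangement.injective A)) (injective⇒≤ position-injective)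
  where
  position-injective : Injective _≡_ _≡_ (λ v → proj₁ (covers (∈-allFin v)))
  position-injective {u} {v} eq = trans (sym (proj₂ (covers (∈-allFin u))))
    (trans (cong (Arrangement.place A) eq) (proj₂ (covers (∈-allFin v))))
...   | refl = A , λ v → covers (∈-allFin v)

module _ {H : Graph h} (A : Arrangement H h) (all-placed : ∀ v → Placed A v) where

  private
    open Arrangement A renaming (injective to place-injective; adjacency to place-adjacency)

    S : Graph h
    S = sequenceGraph links h

    position : Fin h → Fin h
    position v = proj₁ (all-placed v)

    place∘position : ∀ v → place (position v) ≡ v
    place∘position v = proj₂ (all-placed v)

    position∘place : ∀ i → position (place i) ≡ i
    position∘place i = place-injective (place∘position (place i))

  module _ {V : Fin n → Set} {E : Fin n → Fin n → Set} where

    isomorphic⇒ : IsomorphicTo H V E → IsomorphicTo S V E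
    isomorphic⇒ (f , iso) = f ∘ place , record
      { injective = place-injective ∘ injective iso
      ; image     = λ v → mk⇔
          (λ p → let (i , eq) = to (image iso v) p in position i , trans (cong f (place∘position i)) eq)
          (λ (i , eq) → from (image iso v) (place i , eq))
      ; adjacency = λ i j → mk⇔
          (to (adjacency iso (place i) (place j)) ∘ to (place-adjacency i j))
          (from (place-adjacency i j) ∘ from (adjacency iso (place i) (place j)))
      }

    isomorphic⇐ : IsomorphicTo S V E → IsomorphicTo H V E
    isomorphic⇐ (f , iso) = f ∘ position , record
      { injective = λ {u} {v} eq →
          trans (sym (place∘position u)) (trans (cong place (injective iso eq)) (place∘position v))
      ; image     = λ v → mk⇔
          (λ p → let (i , eq) = to (image iso v) p in place i , trans (cong f (position∘place i)) eq)
          (λ (i , eq) → from (image iso v) (position i , eq))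
      ; adjacency = λ u v → mk⇔
          (λ adj → to (adjacency iso _ _) (from (place-adjacency _ _)
            (subst₂ (Adj H) (sym (place∘position u)) (sym (place∘position v)) adj)))
          (λ e → subst₂ (Adj H) (place∘position u) (place∘position v)
            (to (place-adjacency _ _) (from (adjacency iso _ _) e)))
      }

  𝓝-arrangement : (G : Graph n) → 𝓝 H G ≡ 𝓝 S G
  𝓝-arrangement {n} G = trans (𝓝-as-∑ H G) (trans
    (∑-cong (codes n) λ X → 𝟙-cong (isCopy? H G X) (isCopy? S G X)
      (λ (sub , iso) → sub , isomorphic⇒ iso) (λ (sub , iso) → sub , isomorphic⇐ iso))
    (sym (𝓝-as-∑ S G)))

theorem3 : ∀ {h : ℕ} (H : Graph h) → LinearForest H →
    ∀ (k n : ℕ) .{{_ : NonZero k}} .{{_ : NonZero n}} →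
    ∀ (G : Graph n) → IsCompletePartite k G →
    ∀ (T : Graph n) → IsTurán k T →
    𝓝 H G ≤ 𝓝 H T
theorem3 {h} H forest k n G (c , partite) T (c′ , partite′ , balanced) with full-arrangement H forest
... | A , placed = subst₂ _≤_ (sym (𝓝-arrangement A placed G)) (sym (𝓝-arrangement A placed T))
  (𝓝-mono (sequenceGraph links h) G T
    (subst₂ _≤_ (sym (embeddings≡sequences c G partite links h x₀))
                (sym (embeddings≡sequences c′ T partite′ links h x₀))
      (sequences-maximal c′ balanced c links h x₀)))
  where
  open Arrangement A using (links)
  -- `sequences` asks for the part of a predecessor. The first vertex is unlinked, so any part will
  -- do, and one exists because `k` is nonzero.
  x₀ : Fin k
  x₀ = fromℕ< (>-nonZero⁻¹ k)
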